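{- Every finite simple bipartite graph with no vertex of degree $0$ or $2$ admits an antimagic orientation.
   Context: All graphs are finite and simple; graphs are not assumed to be connected. An orientation $D$ of a graph $G$ is a directed graph obtained by assigning one direction to each edge of $G$; $A(D)$ denotes its set of arcs. Let $D$ be a directed graph with $m$ arcs and let $\sigma: A(D)\to\mathbb{Z}$ be an injective labeling. The oriented vertex sum at a vertex $v$ is the sum of the labels of all arcs entering $v$ minus the sum of the labels of all arcs leaving $v$. An antimagic labeling of $D$ is a bijection $\sigma: A(D)\to\{1,\ldots,m\}$ such that the oriented vertex sums of all vertices of $D$ are pairwise distinct. A graph $G$ admits an antimagic orientation if some orientation of $G$ has an antimagic labeling. -}

module Defs where

import Algebra.Properties.CommutativeMonoid.Sum as Sum
open import Data.Bool.Base using (Bool; T; if_then_else_)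
open import Data.Bool.Properties using (T?)
open import Data.Fin.Base using (Fin; toℕ)
open import Data.Integer.Base using (ℤ; +_; 0ℤ; _-_)
import Data.Integer.Properties as ℤₚ
open import Data.Nat.Base using (ℕ; suc)
import Data.Nat.Properties as ℕₚ
open import Data.Product.Base using (Σ-syntax; ∃-syntax; _×_; _,_)
open import Data.Sum.Base using (_⊎_)
open import Function.Bundles using (_⤖_; module Bijection)
open import Function.Definitions using (Injective)
open import Level using (0ℓ)
open import Relation.Binary.Core using (Rel)
open import Relation.Binary.Definitions using (Symmetric; Irreflexive; Asymmetric)
open import Relation.Binary.PropositionalEquality.Core using (_≡_; _≢_)
open import Relation.Nullary.Decidable.Core using (yes; no)

module ℕΣ = Sum ℕₚ.+-0-commutativeMonoid
module ℤΣ = Sum ℤₚ.+-0-commutativeMonoid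

count : ∀ {n} → (Fin n → Bool) → ℕ
count p = ℕΣ.sum (λ i → if p i then 1 else 0)

-- Relations are Bool-valued so that they are decidable and `T (adj u v)` has
-- at most one element: an edge or arc carries no data besides its ends.
record Graph (n : ℕ) : Set where
  field
    adj : Fin n → Fin n → Bool

  Adj : Rel (Fin n) 0ℓ
  Adj u v = T (adj u v)

  field
    symmetric : Symmetric Adj
    loopless  : Irreflexive _≡_ Adj

  degree : Fin n → ℕ
  degree v = count (adj v)

  Bipartite : Set
  Bipartite = Σ[ side ∈ (Fin n → Bool) ] (∀ {u v} → Adj u v → side u ≢ side v)

record Digraph (n : ℕ) : Set where
  field
    arc : Fin n → Fin n → Bool

  -- `Arrow u v`: there is an arc leaving u and entering v.
  Arrow : Rel (Fin n) 0ℓ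
  Arrow u v = T (arc u v)

  Arc : Set
  Arc = Σ[ u ∈ Fin n ] Σ[ v ∈ Fin n ] Arrow u v

  size : ℕ
  size = ℕΣ.sum (λ u → count (arc u))

  labelOf : (Arc → ℤ) → Fin n → Fin n → ℤ
  labelOf σ u v with T? (arc u v)
  ... | yes a = σ (u , v , a)
  ... | no  _ = 0ℤ

  vertexSum : (Arc → ℤ) → Fin n → ℤ
  vertexSum σ v = ℤΣ.sum (λ u → labelOf σ u v) - ℤΣ.sum (λ w → labelOf σ v w)

  -- The element i of Fin size stands for the label 1 + i.
  label : Arc ⤖ Fin size → Arc → ℤ
  label σ a = + suc (toℕ (Bijection.to σ a))

  IsAntimagic : Arc ⤖ Fin size → Set
  IsAntimagic σ = Injective _≡_ _≡_ (vertexSum (label σ))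

record IsOrientation {n : ℕ} (G : Graph n) (D : Digraph n) : Set where
  open Graph G
  open Digraph D
  field
    arrow⇒adj  : ∀ {u v} → Arrow u v → Adj u v
    adj⇒arrow  : ∀ {u v} → Adj u v → Arrow u v ⊎ Arrow v u
    asymmetric : Asymmetric Arrow

AdmitsAntimagicOrientation : ∀ {n} → Graph n → Set
AdmitsAntimagicOrientation {n} G =
  Σ[ D ∈ Digraph n ] IsOrientation G D × (∃[ σ ] Digraph.IsAntimagic D σ)

{-# OPTIONS --safe #-}
module Submission where

-- By Kőnig's theorem the vertices split into a vertex cover W and an independent
-- set Z, and W is matched into Z; as no vertex is isolated, every z in Z can be
-- given a chosen neighbour in W so that each w in W is chosen at least once.
-- Edges between W and Z are directed into Z. The edges inside W get the smallest
-- labels 1..s along trails with increasing labels, which bounds the excess that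
-- they give to a vertex by s. Hence sums are positive on Z and negative on W.
--
-- At z the edges other than the chosen one are split into pairs with label sum
-- M, except for one triple when the degree is even (and so at least 4). With x
-- the largest chosen label, all triples have the sum M + (x + p + 1), where p is
-- the number of pairs, so the sum at z determines its chosen label modulo M,
-- no matter how the chosen labels are distributed. They can therefore be spent
-- on separating W: always give the largest remaining labels to the vertex for
-- which this yields the largest total.

open import Defs
import Algebra.Solver.CommutativeMonoid as CommutativeMonoidSolver
open import Data.Bool.Base using (Bool; true; false; T; if_then_else_)
open import Data.Bool.Properties as Bool using (T?; T-irrelevant)
open import Data.Empty using (⊥-elim)
open import Data.Fin.Base as Fin using (Fin; zero; suc; toℕ; cast)
open import Data.Fin.Properties as Finₚ
  using (_≟_; <-cmp; toℕ-injective; toℕ-cast; cast-involutive; injective⇒≤; any?)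
open import Data.Integer.Base as ℤ using (ℤ; 0ℤ) renaming (+_ to pos)
import Data.Integer.Properties as ℤₚ
open import Data.Integer.Tactic.RingSolver using () renaming (solve-∀ to solve-∀ℤ)
open import Data.List.Base
  using (List; []; _∷_; _++_; map; length; lookup; filter; concatMap; take; drop; zip; allFin; tabulate)
import Data.List.Membership.DecPropositional as DecMembership
open import Data.List.Membership.Propositional using (_∈_; _∉_; find; lose)
open import Data.List.Membership.Propositional.Properties
open import Data.List.Membership.Propositional.Properties.WithK using (unique∧set⇒bag)
open import Data.List.Properties
  using ( length-map; length-++; length-take; length-drop; map-∘; map-id; map-cong; map-++; ++-assoc
        ; take++drop≡id; concatMap-++; ∷-injectiveˡ; ∷-injectiveʳ)
open import Data.List.Relation.Binary.BagAndSetEquality using (∼bag⇒↭)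
open import Data.List.Relation.Binary.Permutation.Propositional
  using (_↭_; ↭-refl; ↭-sym; ↭-trans; ↭-reflexive; prep; swap; ↭⇒↭ₛ; module PermutationReasoning)
import Data.List.Relation.Binary.Permutation.Propositional.Properties as Perm
import Data.List.Relation.Binary.Permutation.Setoid.Properties as SetoidPerm
open import Data.List.Relation.Unary.All as All using (All; []; _∷_)
import Data.List.Relation.Unary.All.Properties as Allₚ
open import Data.List.Relation.Unary.AllPairs as AllPairs using (AllPairs; []; _∷_)
import Data.List.Relation.Unary.AllPairs.Properties as AllPairsₚ
open import Data.List.Relation.Unary.Any using (here; there; index)
import Data.List.Relation.Unary.Any.Properties as Anyₚ
open import Data.List.Relation.Unary.Unique.Propositional using (Unique)
import Data.List.Relation.Unary.Unique.Propositional.Properties as Uniqueₚ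
open import Data.Nat.Base as ℕ using (ℕ; zero; suc; _+_; _*_; _≤_; _<_; z≤n; s≤s)
open import Data.Nat.DivMod using (_%_; [m+kn]%n≡m%n; m<n⇒m%n≡m)
open import Data.Nat.ListAction using (sum)
open import Data.Nat.ListAction.Properties using (sum-++; sum-↭)
import Data.Nat.Properties as ℕₚ
open import Data.Nat.Tactic.RingSolver using (solve-∀)
open import Data.Product.Base using (∃-syntax; _×_; _,_; proj₁; proj₂; map₂) renaming (swap to flip)
open import Data.Product.Properties using (≡-dec)
open import Data.Sum.Base as Sum using (_⊎_; inj₁; inj₂; [_,_]′)
open import Function.Base using (_∘_; case_of_; id)
open import Function.Bundles using (_⤖_; mk⤖; mk⇔)
open import Function.Definitions using (Injective; Surjective)
open import Level using (0ℓ)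
open import Relation.Binary.Definitions using (tri<; tri≈; tri>)
open import Relation.Binary.PropositionalEquality as ≡
  using (_≡_; _≢_; refl; sym; cong; cong₂; subst; subst₂; module ≡-Reasoning)
open import Relation.Binary.PropositionalEquality.Properties using (setoid)
open import Relation.Nullary using (¬_; Dec; yes; no; does)
open import Relation.Nullary.Decidable using (_×-dec_; _⊎-dec_; ¬?; decidable-stable)
open import Relation.Unary using (Pred; Decidable)

private
  variable
    n : ℕ

-- Lists of labelled arcs

Edge : ℕ → Set
Edge n = Fin n × Fin n

LabelledArc : ℕ → Set
LabelledArc n = Edge n × ℕ

arcs : List (LabelledArc n) → List (Edge n)
arcs = map proj₁

labels : List (LabelledArc n) → List ℕ
labels = map proj₂

only : Fin n → Fin n → ℕ → ℕ
only u v l = if does (u ≟ v) then l else 0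

inSum outSum : List (LabelledArc n) → Fin n → ℕ
inSum  Λ v = sum (map (λ ((_ , b) , l) → only b v l) Λ)
outSum Λ v = sum (map (λ ((a , _) , l) → only a v l) Λ)

excess : List (LabelledArc n) → Fin n → ℤ
excess Λ v = pos (inSum Λ v) ℤ.- pos (outSum Λ v)

only-≡ : ∀ (v : Fin n) l → only v v l ≡ l
only-≡ v l with v ≟ v
... | yes _ = refl
... | no v≢v = ⊥-elim (v≢v refl)

only-≢ : ∀ {u v : Fin n} l → u ≢ v → only u v l ≡ 0
only-≢ {u = u} {v} l u≢v with u ≟ v
... | yes u≡v = ⊥-elim (u≢v u≡v)
... | no _ = refl

only-0 : ∀ (u v : Fin n) → only u v 0 ≡ 0
only-0 u v with u ≟ v
... | yes _ = refl
... | no _ = refl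

Σ-0 : ∀ n → ℕΣ.sum {n} (λ _ → 0) ≡ 0
Σ-0 zero = refl
Σ-0 (suc n) = Σ-0 n

Σ-only : ∀ (u : Fin n) l → ℕΣ.sum (λ v → only u v l) ≡ l
Σ-only {suc n} zero l = ≡.trans (cong (l +_) (Σ-0 n)) (ℕₚ.+-identityʳ l)
Σ-only (suc u) l = ≡.trans (ℕΣ.sum-cong-≗ step) (Σ-only u l)
  where
  step : ∀ v → only (suc u) (suc v) l ≡ only u v l
  step v with u ≟ v
  ... | yes refl = refl
  ... | no _ = refl

Σ-+ : ∀ (f : Fin n → ℕ) → ℤΣ.sum (λ v → pos (f v)) ≡ pos (ℕΣ.sum f)
Σ-+ {zero} f = refl
Σ-+ {suc n} f = cong (λ z → pos (f zero) ℤ.+ z) (Σ-+ (f ∘ suc))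

-- If the arcs of `Λ` are distinct, this is the label of the arc from `u` to `v`, and 0 if there is
-- none. Written as a sum over `Λ`, it can be summed over `u` or `v` entry by entry.
arcLabel : List (LabelledArc n) → Fin n → Fin n → ℕ
arcLabel Λ u v = sum (map (λ ((a , b) , l) → only a u (only b v l)) Λ)

Σ-tails : ∀ (Λ : List (LabelledArc n)) v → ℕΣ.sum (λ u → arcLabel Λ u v) ≡ inSum Λ v
Σ-tails {n} [] v = Σ-0 n
Σ-tails {n} (((a , b) , l) ∷ Λ) v = ≡.trans (ℕΣ.∑-distrib-+ {n} (λ u → only a u (only b v l)) _)
  (cong₂ _+_ (Σ-only a _) (Σ-tails Λ v))

Σ-heads : ∀ (Λ : List (LabelledArc n)) u → ℕΣ.sum (λ v → arcLabel Λ u v) ≡ outSum Λ u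
Σ-heads {n} [] u = Σ-0 n
Σ-heads {n} (((a , b) , l) ∷ Λ) u = ≡.trans (ℕΣ.∑-distrib-+ {n} (λ v → only a u (only b v l)) _)
  (cong₂ _+_ (≡.trans step (Σ-only b _)) (Σ-heads Λ u))
  where
  step : ℕΣ.sum (λ v → only a u (only b v l)) ≡ ℕΣ.sum (λ v → only b v (only a u l))
  step with a ≟ u
  ... | yes _ = refl
  ... | no _ = ℕΣ.sum-cong-≗ (λ v → sym (only-0 b v))

arcLabel-∉ : ∀ (Λ : List (LabelledArc n)) {u v} → (u , v) ∉ arcs Λ → arcLabel Λ u v ≡ 0
arcLabel-∉ [] _ = refl
arcLabel-∉ (((a , b) , l) ∷ Λ) {u} {v} ∉Λ = cong₂ _+_ head0 (arcLabel-∉ Λ (∉Λ ∘ there))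
  where
  head0 : only a u (only b v l) ≡ 0
  head0 with a ≟ u | b ≟ v
  ... | no _ | _ = refl
  ... | yes _ | no _ = refl
  ... | yes refl | yes refl = ⊥-elim (∉Λ (here refl))

arcLabel-∈ : ∀ (Λ : List (LabelledArc n)) {u v l} → Unique (arcs Λ) →
  ((u , v) , l) ∈ Λ → arcLabel Λ u v ≡ l
arcLabel-∈ (_ ∷ Λ) {u} {v} {l} (new ∷ _) (here refl)
  rewrite only-≡ v l | only-≡ u l | arcLabel-∉ Λ (Allₚ.All¬⇒¬Any new) = ℕₚ.+-identityʳ l
arcLabel-∈ (((a , b) , k) ∷ Λ) {u} {v} (new ∷ Λ!) (there ∈Λ) = cong₂ _+_ head0 (arcLabel-∈ Λ Λ! ∈Λ)
  where
  head0 : only a u (only b v k) ≡ 0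
  head0 with a ≟ u | b ≟ v
  ... | no _ | _ = refl
  ... | yes _ | no _ = refl
  ... | yes refl | yes refl = ⊥-elim (All.lookup new (∈-map⁺ proj₁ ∈Λ) refl)

-- From a labelled list of arcs to an antimagic orientation

upFrom : ℕ → ℕ → List ℕ
upFrom k zero    = []
upFrom k (suc l) = k ∷ upFrom (suc k) l

_≟ₑ_ : (e f : Edge n) → Dec (e ≡ f)
_≟ₑ_ = ≡-dec _≟_ _≟_

lookup-injective : ∀ {A : Set} {xs : List A} → Unique xs → ∀ i j → lookup xs i ≡ lookup xs j → i ≡ j
lookup-injective (_ ∷ _) zero zero eq = refl
lookup-injective {xs = _ ∷ xs} (new ∷ _) zero (suc j) eq = ⊥-elim (All.lookup new (∈-lookup j) eq)
lookup-injective {xs = _ ∷ xs} (new ∷ _) (suc i) zero eq = ⊥-elim (All.lookup new (∈-lookup i) (sym eq))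
lookup-injective (_ ∷ xs!) (suc i) (suc j) eq = cong suc (lookup-injective xs! i j eq)

-- The label of an arc is its position in the list.
module _ (G : Graph n) (Λ : List (LabelledArc n)) (k : ℕ)
  (Λ-labels : labels Λ ≡ upFrom 1 k) (Λ! : Unique (arcs Λ))
  where
  open Graph G

  private
    open DecMembership (_≟ₑ_ {n}) using (_∈?_)

    D : Digraph n
    D = record { arc = λ u v → does ((u , v) ∈? arcs Λ) }

    open Digraph D

    arrow⇒∈ : ∀ {u v} → Arrow u v → (u , v) ∈ arcs Λ
    arrow⇒∈ {u} {v} a with (u , v) ∈? arcs Λ
    ... | yes ∈Λ = ∈Λ

    ∈⇒arrow : ∀ {u v} → (u , v) ∈ arcs Λ → Arrow u v
    ∈⇒arrow {u} {v} ∈Λ with (u , v) ∈? arcs Λ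
    ... | yes _ = _
    ... | no ∉Λ = ∉Λ ∈Λ

    -- With all labels replaced by 1, `arcLabel` is the indicator of the arcs, so the size of `D`
    -- becomes a double sum that `Σ-heads` evaluates.
    unit : List (LabelledArc n)
    unit = map (map₂ (λ _ → 1)) Λ

    arcs-unit : arcs unit ≡ arcs Λ
    arcs-unit = sym (map-∘ Λ)

    arc-count : ∀ u v → (if arc u v then 1 else 0) ≡ arcLabel unit u v
    arc-count u v with (u , v) ∈? arcs Λ
    ... | no ∉Λ = sym (arcLabel-∉ unit (subst ((u , v) ∉_) (sym arcs-unit) ∉Λ))
    ... | yes ∈Λ with ∈-map⁻ proj₁ ∈Λ
    ...   | _ , e∈Λ , refl =
      sym (arcLabel-∈ unit (subst Unique (sym arcs-unit) Λ!) (∈-map⁺ _ e∈Λ))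

    Σ-unit : ∀ (Λ : List (LabelledArc n)) →
      ℕΣ.sum (λ u → outSum (map (map₂ (λ _ → 1)) Λ) u) ≡ length Λ
    Σ-unit [] = Σ-0 n
    Σ-unit (((a , _) , _) ∷ Λ) = ≡.trans (ℕΣ.∑-distrib-+ {n} (λ u → only a u 1) _)
      (cong₂ _+_ (Σ-only a 1) (Σ-unit Λ))

    size≡ : length (arcs Λ) ≡ size
    size≡ = sym (≡.trans (ℕΣ.sum-cong-≗ (λ u → ≡.trans (ℕΣ.sum-cong-≗ (arc-count u)) (Σ-heads unit u)))
      (≡.trans (Σ-unit Λ) (sym (length-map proj₁ Λ))))

    position : Arc → Fin (length (arcs Λ))
    position (_ , _ , a) = index (arrow⇒∈ a)

    lookup-position : ∀ (e@(u , v , _) : Arc) → lookup (arcs Λ) (position e) ≡ (u , v)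
    lookup-position (_ , _ , a) = sym (Anyₚ.lookup-index (arrow⇒∈ a))

    arc-≡ : ∀ {u v u′ v′} {a : Arrow u v} {a′ : Arrow u′ v′} → (u , v) ≡ (u′ , v′) →
      _≡_ {A = Arc} (u , v , a) (u′ , v′ , a′)
    arc-≡ {u} {v} refl = cong (λ a → u , v , a) (T-irrelevant _ _)

    position-injective : Injective _≡_ _≡_ position
    position-injective {e} {e′} eq = arc-≡
      (≡.trans (sym (lookup-position e)) (≡.trans (cong (lookup (arcs Λ)) eq) (lookup-position e′)))

    arcAt : Fin (length (arcs Λ)) → Arc
    arcAt i = _ , _ , ∈⇒arrow (∈-lookup {xs = arcs Λ} i)

    position-arcAt : ∀ i → position (arcAt i) ≡ i
    position-arcAt i = lookup-injective Λ! _ _ (lookup-position (arcAt i))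

    σ : Arc ⤖ Fin size
    σ = mk⤖ {to = cast size≡ ∘ position} (inj , surj)
      where
      inj : Injective _≡_ _≡_ (cast size≡ ∘ position)
      inj eq = position-injective (toℕ-injective
        (≡.trans (sym (toℕ-cast size≡ _)) (≡.trans (cong toℕ eq) (toℕ-cast size≡ _))))
      surj : Surjective _≡_ _≡_ (cast size≡ ∘ position)
      surj i = arcAt (cast (sym size≡) i) ,
        λ { refl → ≡.trans (cong (cast size≡) (position-arcAt _)) (cast-involutive size≡ (sym size≡) i) }

    -- The start `i` varies for the sake of the induction; for `i` equal to 1 this is the value that
    -- `label` gives to the arc.
    labelled : ∀ (Λ : List (LabelledArc n)) i k → labels Λ ≡ upFrom i k → ∀ {e} →
      (e∈Λ : e ∈ arcs Λ) → (e , i + toℕ (index e∈Λ)) ∈ Λ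
    labelled [] i k eq ()
    labelled ((e , l) ∷ Λ) i (suc k) eq (here refl) =
      here (cong (e ,_) (≡.trans (ℕₚ.+-identityʳ i) (sym (∷-injectiveˡ eq))))
    labelled (_ ∷ Λ) i (suc k) eq {e} (there e∈Λ) = there (subst (λ l → (e , l) ∈ Λ)
      (sym (ℕₚ.+-suc i _)) (labelled Λ (suc i) k (∷-injectiveʳ eq) e∈Λ))

    labelOf≡ : ∀ u v → labelOf (label σ) u v ≡ pos (arcLabel Λ u v)
    labelOf≡ u v with T? (arc u v)
    ... | no ∉Λ = cong pos (sym (arcLabel-∉ Λ (∉Λ ∘ ∈⇒arrow)))
    ... | yes a = cong pos (≡.trans (cong suc (toℕ-cast size≡ (position (u , v , a))))
      (sym (arcLabel-∈ Λ Λ! (labelled Λ 1 k Λ-labels (arrow⇒∈ a)))))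

    vertexSum≡ : ∀ v → vertexSum (label σ) v ≡ excess Λ v
    vertexSum≡ v = cong₂ ℤ._-_
      (≡.trans (ℤΣ.sum-cong-≗ (λ u → labelOf≡ u v))
        (≡.trans (Σ-+ (λ u → arcLabel Λ u v)) (cong pos (Σ-tails Λ v))))
      (≡.trans (ℤΣ.sum-cong-≗ (labelOf≡ v))
        (≡.trans (Σ-+ (arcLabel Λ v)) (cong pos (Σ-heads Λ v))))

  realise-ordered :
    (∀ {u v} → (u , v) ∈ arcs Λ → Adj u v) →
    (∀ {u v} → Adj u v → (u , v) ∈ arcs Λ ⊎ (v , u) ∈ arcs Λ) →
    (∀ {u v} → (u , v) ∈ arcs Λ → (v , u) ∉ arcs Λ) →
    Injective _≡_ _≡_ (excess Λ) → AdmitsAntimagicOrientation G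
  realise-ordered sound complete asym inj = D , record
    { arrow⇒adj = sound ∘ arrow⇒∈
    ; adj⇒arrow = λ uv → case complete uv of λ
        { (inj₁ ∈Λ) → inj₁ (∈⇒arrow ∈Λ) ; (inj₂ ∈Λ) → inj₂ (∈⇒arrow ∈Λ) }
    ; asymmetric = λ a b → asym (arrow⇒∈ a) (arrow⇒∈ b)
    } , σ , λ {u} {v} eq → inj (≡.trans (sym (vertexSum≡ u)) (≡.trans eq (vertexSum≡ v)))

sum-map-↭ : ∀ {A : Set} (f : A → ℕ) {xs ys} → xs ↭ ys → sum (map f xs) ≡ sum (map f ys)
sum-map-↭ f xs↭ys = sum-↭ (Perm.map⁺ f xs↭ys)

Unique-resp-↭ : ∀ {A : Set} {xs ys : List A} → xs ↭ ys → Unique xs → Unique ys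
Unique-resp-↭ p = SetoidPerm.Unique-resp-↭ (setoid _) (↭⇒↭ₛ p)

-- Neither the vertex sums nor the set of arcs depends on the order of the list, so it can be
-- permuted until its labels increase from 1 to `k`.
realise : (G : Graph n) (Λ : List (LabelledArc n)) → let open Graph G in
  ∀ k → labels Λ ↭ upFrom 1 k → Unique (arcs Λ) →
  (∀ {u v} → (u , v) ∈ arcs Λ → Adj u v) →
  (∀ {u v} → Adj u v → (u , v) ∈ arcs Λ ⊎ (v , u) ∈ arcs Λ) →
  (∀ {u v} → (u , v) ∈ arcs Λ → (v , u) ∉ arcs Λ) →
  Injective _≡_ _≡_ (excess Λ) → AdmitsAntimagicOrientation G
realise G Λ k Λ-labels Λ! sound complete asym inj with Perm.↭-map-inv proj₂ Λ-labels
... | Λ′ , labels≡ , Λ↭Λ′ = realise-ordered G Λ′ k (sym labels≡) (Unique-resp-↭ arcs↭ Λ!)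
  (sound ∘ from)
  (λ uv → case complete uv of λ { (inj₁ ∈Λ) → inj₁ (to ∈Λ) ; (inj₂ ∈Λ) → inj₂ (to ∈Λ) })
  (λ ∈Λ ∈Λ′ → asym (from ∈Λ) (from ∈Λ′))
  (λ {u} {v} eq → inj (≡.trans (excess≡ u) (≡.trans eq (sym (excess≡ v)))))
  where
  arcs↭ : arcs Λ ↭ arcs Λ′
  arcs↭ = Perm.map⁺ proj₁ Λ↭Λ′
  to : ∀ {e} → e ∈ arcs Λ → e ∈ arcs Λ′
  to = Perm.∈-resp-↭ arcs↭
  from : ∀ {e} → e ∈ arcs Λ′ → e ∈ arcs Λ
  from = Perm.∈-resp-↭ (↭-sym arcs↭)
  excess≡ : ∀ v → excess Λ v ≡ excess Λ′ v
  excess≡ v = cong₂ (λ i o → pos i ℤ.- pos o) (sum-map-↭ _ Λ↭Λ′) (sum-map-↭ _ Λ↭Λ′)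

-- Kőnig's theorem via alternating paths

injective-on-list : ∀ {A B : Set} {f : A → B} {xs : List A} → Unique (map f xs) →
  ∀ {x y} → x ∈ xs → y ∈ xs → f x ≡ f y → x ≡ y
injective-on-list (new ∷ fxs!) (here refl) (here refl) eq = refl
injective-on-list (new ∷ fxs!) (here refl) (there y∈) eq = ⊥-elim (All.lookup new (∈-map⁺ _ y∈) eq)
injective-on-list (new ∷ fxs!) (there x∈) (here refl) eq = ⊥-elim (All.lookup new (∈-map⁺ _ x∈) (sym eq))
injective-on-list (new ∷ fxs!) (there x∈) (there y∈) eq = injective-on-list fxs! x∈ y∈ eq

Unique-length≤ : ∀ {xs : List (Fin n)} → Unique xs → length xs ≤ n
Unique-length≤ xs! = injective⇒≤ (λ {i} {j} → lookup-injective xs! i j)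

fresh : ∀ {A : Set} {x : A} {xs} → x ∉ xs → All (x ≢_) xs
fresh {xs = []} _ = []
fresh {xs = y ∷ ys} x∉ = (x∉ ∘ here) ∷ fresh (x∉ ∘ there)

-- The form in which Kőnig's theorem is used: by `cover` the complement of `W` is independent, and
-- the edges from `centre z` to `z`, for z outside `W`, form nonempty stars around all vertices of
-- `W`.
record StarCover (G : Graph n) : Set₁ where
  open Graph G
  field
    W          : Pred (Fin n) 0ℓ
    W?         : Decidable W
    centre     : Fin n → Fin n
    cover      : ∀ {u v} → Adj u v → ¬ W u → W v
    centre-adj : ∀ v → Adj (centre v) v
    centre-onto : ∀ {w} → W w → ∃[ z ] ¬ W z × centre z ≡ w

module König (G : Graph n) (bipartite : Graph.Bipartite G)
  (neighbour : ∀ v → ∃[ u ] Graph.Adj G v u) where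
  open Graph G
  open DecMembership (_≟_ {n}) using () renaming (_∈?_ to _∈ᵥ?_)
  open DecMembership (_≟ₑ_ {n}) using () renaming (_∈?_ to _∈ₑ?_)

  private
    side : Fin n → Bool
    side = proj₁ bipartite

    crosses : ∀ {u v} → Adj u v → side u ≢ side v
    crosses = proj₂ bipartite

    side-false : ∀ {u v} → Adj u v → side u ≡ true → side v ≡ false
    side-false {u} {v} uv su with side v in sv
    ... | false = refl
    ... | true = ⊥-elim (crosses uv (≡.trans su (sym sv)))

    side-true : ∀ {u v} → Adj u v → side u ≡ false → side v ≡ true
    side-true {u} {v} uv su with side v in sv
    ... | true = refl
    ... | false = ⊥-elim (crosses uv (≡.trans su (sym sv)))

  record Matching (M : List (Edge n)) : Set where
    constructor matching
    field
      edges    : All (λ (x , y) → side x ≡ true × Adj x y) M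
      firsts!  : Unique (map proj₁ M)
      seconds! : Unique (map proj₂ M)
  open Matching

  Matching-resp-↭ : ∀ {M N} → M ↭ N → Matching M → Matching N
  Matching-resp-↭ p (matching es f! s!) = matching (Perm.All-resp-↭ p es)
    (Unique-resp-↭ (Perm.map⁺ proj₁ p) f!) (Unique-resp-↭ (Perm.map⁺ proj₂ p) s!)

  -- Obtained from M by flipping an alternating path inside R that ends in r.
  record Freed (M : List (Edge n)) (R : List (Fin n)) (r : Fin n) : Set where
    constructor freed
    field
      {rest}      : List (Edge n)
      rest-match  : Matching rest
      avoids      : r ∉ map proj₁ rest
      seconds↭    : map proj₂ rest ↭ map proj₂ M
      agrees      : ∀ {a y} → a ∉ R → (a , y) ∈ M → (a , y) ∈ rest

  -- A set of left vertices reached by alternating paths from unmatched ones. A path is remembered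
  -- only through the matching that results from flipping it.
  record Alternating (M : List (Edge n)) (R : List (Fin n)) : Set where
    field
      R!        : Unique R
      left      : All (λ r → side r ≡ true) R
      unmatched : ∀ {x} → side x ≡ true → x ∉ map proj₁ M → x ∈ R
      frees     : All (Freed M R) R
  open Alternating

  -- The condition under which the search stops: no edge at `R` completes an augmenting path or
  -- reaches a new left vertex.
  Closed : List (Edge n) → List (Fin n) → Set
  Closed M R = ∀ {r y} → r ∈ R → Adj r y → ∃[ a ] a ∈ R × (a , y) ∈ M

  -- The flipped matching misses `r` and has the same right ends as `M`, hence misses `y` as well,
  -- so the edge from `r` to `y` can be added to it.
  augment : ∀ {M R r y} → Freed M R r → side r ≡ true → Adj r y → y ∉ map proj₂ M →
    ∃[ M′ ] Matching M′ × length M′ ≡ suc (length M)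
  augment {M} {r = r} {y} (freed {M′} m r∉ s↭ _) sr ry y∉ = (r , y) ∷ M′ ,
    matching ((sr , ry) ∷ edges m) (fresh r∉ ∷ firsts! m)
      (fresh (y∉ ∘ Perm.∈-resp-↭ s↭) ∷ seconds! m) ,
    cong suc (≡.trans (sym (length-map proj₂ M′)) (≡.trans (Perm.↭-length s↭) (length-map proj₂ M)))

  -- As `a` is outside `R`, the pair `(a , y)` has survived the flip. Exchanging it for `(r , y)`
  -- keeps the right ends and frees `a`.
  free-next : ∀ {M R r a y} → Freed M R r → r ∈ R → side r ≡ true → Adj r y → a ∉ R → (a , y) ∈ M →
    Freed M (a ∷ R) a
  free-next {M} {R} {r} {a} {y} (freed {M′} m r∉ s↭ agrees) r∈R sr ry a∉R ay∈M
    with ∈-∃++ (agrees a∉R ay∈M)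
  ... | ys , zs , refl = go (Matching-resp-↭ p m)
    where
    p : ys ++ (a , y) ∷ zs ↭ (a , y) ∷ ys ++ zs
    p = Perm.shift (a , y) ys zs
    go : Matching ((a , y) ∷ ys ++ zs) → Freed M (a ∷ R) a
    go (matching (_ ∷ es) (a# ∷ f!) (y# ∷ s!)) = freed
      (matching ((sr , ry) ∷ es)
        (fresh (λ r∈ → r∉ (Perm.∈-resp-↭ (Perm.map⁺ proj₁ (↭-sym p)) (there r∈))) ∷ f!) (y# ∷ s!))
      (λ { (here refl) → a∉R r∈R ; (there a∈) → Allₚ.All¬⇒¬Any a# a∈ })
      (↭-trans (↭-sym (Perm.map⁺ proj₂ p)) s↭)
      (λ {b} {y′} b∉ by∈M → case Perm.∈-resp-↭ p (agrees (b∉ ∘ there) by∈M) of λ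
        { (here refl) → ⊥-elim (b∉ (here refl)) ; (there ∈rest) → there ∈rest })

  step? : ∀ M R → (∃[ r ] r ∈ R × ∃[ y ] Adj r y × ¬ (∃[ a ] a ∈ R × (a , y) ∈ M)) ⊎ Closed M R
  step? M R with any? (λ r → (r ∈ᵥ? R) ×-dec any? (λ y → T? (adj r y) ×-dec
                     ¬? (any? (λ a → (a ∈ᵥ? R) ×-dec ((a , y) ∈ₑ? M)))))
  ... | yes found = inj₁ found
  ... | no none = inj₂ (λ {r} {y} r∈R ry → decidable-stable
    (any? (λ a → (a ∈ᵥ? R) ×-dec ((a , y) ∈ₑ? M))) (λ ¬a → none (r , r∈R , y , ry , ¬a)))

  -- `k` is fuel: every extension lengthens `R`, which has at most `n` entries. If `y` is unmatched
  -- there is an augmenting path; otherwise the partner of `y` joins `R`.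
  grow : ∀ k {M R} → n < k + length R → Matching M → Alternating M R →
    (∃[ R′ ] Alternating M R′ × Closed M R′) ⊎ (∃[ M′ ] Matching M′ × length M′ ≡ suc (length M))
  grow zero n< m alt = ⊥-elim (ℕₚ.<⇒≱ n< (Unique-length≤ (R! alt)))
  grow (suc k) {M} {R} n< m alt with step? M R
  ... | inj₂ closed = inj₁ (R , alt , closed)
  ... | inj₁ (r , r∈R , y , ry , none) with any? (λ a → (a , y) ∈ₑ? M)
  ...   | no y∉ = inj₂ (augment (All.lookup (frees alt) r∈R) (All.lookup (left alt) r∈R) ry
            (λ y∈ → case ∈-map⁻ proj₂ y∈ of λ { ((a , _) , ay∈M , refl) → y∉ (a , ay∈M) }))
  ...   | yes (a , ay∈M) = grow k (subst (n <_) (sym (ℕₚ.+-suc k (length R))) n<) m (record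
            { R! = fresh a∉R ∷ R! alt
            ; left = proj₁ (All.lookup (edges m) ay∈M) ∷ left alt
            ; unmatched = λ sx x∉ → there (unmatched alt sx x∉)
            ; frees = free-next (All.lookup (frees alt) r∈R) r∈R (All.lookup (left alt) r∈R) ry a∉R ay∈M
                ∷ All.map (λ (freed m′ r∉ s↭ ag) → freed m′ r∉ s↭ (λ b∉ → ag (b∉ ∘ there))) (frees alt)
            })
          where
          a∉R : a ∉ R
          a∉R a∈R = none (a , a∈R , ay∈M)

  -- The search starts from the unmatched left vertices, whose alternating paths are empty.
  alternating : ∀ {M} → Matching M → ∃[ R ] Alternating M R
  alternating {M} m = R , record
    { R! = Uniqueₚ.filter⁺ U? (Uniqueₚ.allFin⁺ n)
    ; left = All.map proj₁ (Allₚ.all-filter U? (allFin n))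
    ; unmatched = λ {x} sx x∉ → ∈-filter⁺ U? (∈-allFin x) (sx , x∉)
    ; frees = All.map (λ (_ , x∉) → freed m x∉ ↭-refl (λ _ → id)) (Allₚ.all-filter U? (allFin n))
    }
    where
    U? : Decidable (λ x → side x ≡ true × x ∉ map proj₁ M)
    U? x = (side x Bool.≟ true) ×-dec ¬? (x ∈ᵥ? map proj₁ M)
    R : List (Fin n)
    R = filter U? (allFin n)

  -- `k` is fuel again: each augmentation adds an edge, and a matching has at most `n` edges.
  maximise : ∀ k {M} → n < k + length M → Matching M →
    ∃[ M′ ] Matching M′ × ∃[ R ] Alternating M′ R × Closed M′ R
  maximise zero {M} n< m = ⊥-elim (ℕₚ.<⇒≱ n<
    (subst (_≤ n) (length-map proj₁ M) (Unique-length≤ (firsts! m))))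
  maximise (suc k) {M} n< m with alternating m
  ... | R , alt with grow (suc n) (s≤s (ℕₚ.m≤m+n n _)) m alt
  ...   | inj₁ (R′ , alt′ , closed) = M , m , R′ , alt′ , closed
  ...   | inj₂ (M′ , m′ , len) = maximise k
            (subst (n <_) (sym (≡.trans (cong (k +_) len) (ℕₚ.+-suc k (length M)))) n<) m′

  starCover : StarCover G
  starCover with maximise (suc n) (s≤s (ℕₚ.m≤m+n n 0)) (matching [] [] [])
  ... | M , m , R , alt , closed = record
    { W = W ; W? = W? ; centre = centre ; cover = cover
    ; centre-adj = centre-adj ; centre-onto = centre-onto }
    where
    -- Kőnig's vertex cover, where `R` plays the role of the left vertices reached by alternating
    -- paths.
    W : Pred (Fin n) 0ℓ
    W v = (side v ≡ true × v ∉ R) ⊎ (∃[ a ] a ∈ R × (a , v) ∈ M)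

    W? : Decidable W
    W? v = ((side v Bool.≟ true) ×-dec ¬? (v ∈ᵥ? R)) ⊎-dec
      any? (λ a → (a ∈ᵥ? R) ×-dec ((a , v) ∈ₑ? M))

    -- If the left end of an edge is in `R`, the right end is in `W` by `closed`; otherwise the left
    -- end itself is in `W`.
    cover : ∀ {u v} → Adj u v → ¬ W u → W v
    cover {u} {v} uv ¬Wu with side u in su
    ... | true = inj₂ (closed (decidable-stable (u ∈ᵥ? R) (λ u∉ → ¬Wu (inj₁ (refl , u∉)))) uv)
    ... | false = inj₁ (side-true uv su , λ v∈R → ¬Wu (inj₂ (closed v∈R (symmetric uv))))

    -- The partner in the matching, with `v` tried as a left end and then as a right end; an
    -- unmatched vertex falls back on some neighbour.
    centre : Fin n → Fin n
    centre v with any? (λ u → (v , u) ∈ₑ? M) | any? (λ u → (u , v) ∈ₑ? M)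
    ... | yes (u , _) | _           = u
    ... | no _        | yes (u , _) = u
    ... | no _        | no _        = proj₁ (neighbour v)

    centre-adj : ∀ v → Adj (centre v) v
    centre-adj v with any? (λ u → (v , u) ∈ₑ? M) | any? (λ u → (u , v) ∈ₑ? M)
    ... | yes (u , vu) | _            = symmetric (proj₂ (All.lookup (edges m) vu))
    ... | no _         | yes (u , uv) = proj₂ (All.lookup (edges m) uv)
    ... | no _         | no _         = symmetric (proj₂ (neighbour v))

    left-of : ∀ {x y} → (x , y) ∈ M → side x ≡ true
    left-of xy = proj₁ (All.lookup (edges m) xy)

    right-of : ∀ {x y} → (x , y) ∈ M → side y ≡ false
    right-of xy = side-false (proj₂ (All.lookup (edges m) xy)) (left-of xy)

    one-side : ∀ {v} {A : Set} → side v ≡ true → side v ≡ false → A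
    one-side t f = case ≡.trans (sym t) f of λ ()

    centre-left : ∀ {x y} → (x , y) ∈ M → centre x ≡ y
    centre-left {x} xy with any? (λ u → (x , u) ∈ₑ? M)
    ... | yes (u , xu) = cong proj₂ (injective-on-list (firsts! m) xu xy refl)
    ... | no none = ⊥-elim (none (_ , xy))

    centre-right : ∀ {x y} → (x , y) ∈ M → centre y ≡ x
    centre-right {x} {y} xy with any? (λ u → (y , u) ∈ₑ? M) | any? (λ u → (u , y) ∈ₑ? M)
    ... | yes (u , yu) | _ = one-side (left-of yu) (right-of xy)
    ... | no _ | yes (u , uy) = cong proj₁ (injective-on-list (seconds! m) uy xy refl)
    ... | no _ | no none = ⊥-elim (none (_ , xy))

    -- A left vertex outside `R` is matched by `unmatched`, and a partner in `W` would put it into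
    -- `R`. A right vertex of `W` has its partner in `R`, and left vertices in `R` are outside `W`.
    centre-onto : ∀ {w} → W w → ∃[ z ] ¬ W z × centre z ≡ w
    centre-onto {w} (inj₁ (sw , w∉R)) with ∈-map⁻ proj₁
      (decidable-stable (w ∈ᵥ? map proj₁ M) (w∉R ∘ unmatched alt sw))
    ... | (_ , y) , wy , refl = y , ¬Wy , centre-right wy
      where
      ¬Wy : ¬ W y
      ¬Wy (inj₁ (sy , _)) = one-side sy (right-of wy)
      ¬Wy (inj₂ (a , a∈R , ay)) =
        w∉R (subst (_∈ R) (cong proj₁ (injective-on-list (seconds! m) ay wy refl)) a∈R)
    centre-onto {w} (inj₂ (a , a∈R , aw)) = a , ¬Wa , centre-left aw
      where
      ¬Wa : ¬ W a
      ¬Wa (inj₁ (_ , a∉R)) = a∉R a∈R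
      ¬Wa (inj₂ (b , _ , ba)) = one-side (left-of aw) (right-of ba)

-- Trails inside the cover

only-≤ : ∀ (v w : Fin n) l → only v w l ≤ l
only-≤ v w l with v ≟ w
... | yes _ = ℕₚ.≤-refl
... | no _ = z≤n

only-mono : ∀ (v w : Fin n) {k l} → k ≤ l → only v w k ≤ only v w l
only-mono v w k≤l with v ≟ w
... | yes _ = k≤l
... | no _ = z≤n

Misses : Fin n → Edge n → Set
Misses w (x , y) = x ≢ w × y ≢ w

-- A trail that arrives at v with label a goes on with label a + 1, so a vertex
-- only keeps an uncompensated entering label if the trail stops there; then
-- all its edges are used up, and this happens to it at most once.
module TrailLabelling (norm : Edge n → Edge n) (norm-flip : ∀ e → norm (flip e) ≡ norm e) where

  -- The trail stands at `v`, where it has arrived with label `a`, and `R` are the edges still to be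
  -- labelled. In `balance` this pending label counts as entering `v`, and `a + length R` is the
  -- largest label in use. `norm` serves to identify an edge with its reverse.
  record Trail (R : List (Edge n)) (v : Fin n) (a : ℕ) : Set where
    field
      Λ       : List (LabelledArc n)
      labels≡ : labels Λ ≡ upFrom (suc a) (length R)
      arcs↭   : map norm (arcs Λ) ↭ map norm R
      missed  : ∀ {w} → All (Misses w) R → inSum Λ w ≡ 0 × outSum Λ w ≡ 0
      balance : ∀ w → inSum Λ w + only v w a ≤ outSum Λ w + (a + length R)
  open Trail

  -- The label `suc a` leaves `v` and outweighs the label `a` pending there; at `u` it becomes the
  -- pending label of the remaining trail.
  prepend : ∀ {R R′} e {v u a} → R ↭ e ∷ R′ → (v , u) ≡ e ⊎ (v , u) ≡ flip e →
    Trail R′ u (suc a) → Trail R v a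
  prepend {R} {R′} e {v} {u} {a} p e≡ t = record
    { Λ = ((v , u) , suc a) ∷ Λ t
    ; labels≡ = ≡.trans (cong (suc a ∷_) (labels≡ t)) (cong (upFrom (suc a)) (sym len))
    ; arcs↭ = ↭-trans (↭-reflexive (cong (_∷ map norm (arcs (Λ t))) (norm≡ e≡)))
        (↭-trans (prep _ (arcs↭ t)) (↭-sym (Perm.map⁺ norm p)))
    ; missed = missed′
    ; balance = balance′
    }
    where
    len : length R ≡ suc (length R′)
    len = Perm.↭-length p
    norm≡ : (v , u) ≡ e ⊎ (v , u) ≡ flip e → norm (v , u) ≡ norm e
    norm≡ (inj₁ refl) = refl
    norm≡ (inj₂ refl) = norm-flip e
    misses : ∀ {w} → (v , u) ≡ e ⊎ (v , u) ≡ flip e → Misses w e → Misses w (v , u)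
    misses (inj₁ refl) m = m
    misses (inj₂ refl) m = flip m
    missed′ : ∀ {w} → All (Misses w) R →
      only u w (suc a) + inSum (Λ t) w ≡ 0 × only v w (suc a) + outSum (Λ t) w ≡ 0
    missed′ R-misses with Perm.All-resp-↭ p R-misses
    ... | m ∷ ms with misses e≡ m | missed t ms
    ...   | v≢w , u≢w | in≡0 , out≡0 = cong₂ _+_ (only-≢ _ u≢w) in≡0 , cong₂ _+_ (only-≢ _ v≢w) out≡0
    balance′ : ∀ w → only u w (suc a) + inSum (Λ t) w + only v w a
      ≤ only v w (suc a) + outSum (Λ t) w + (a + length R)
    balance′ w = begin
      only u w (suc a) + inSum (Λ t) w + only v w a
        ≡⟨ cong (_+ only v w a) (ℕₚ.+-comm (only u w (suc a)) _) ⟩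
      inSum (Λ t) w + only u w (suc a) + only v w a
        ≤⟨ ℕₚ.+-mono-≤ (balance t w) (only-mono v w (ℕₚ.n≤1+n a)) ⟩
      outSum (Λ t) w + (suc a + length R′) + only v w (suc a)
        ≡⟨ rearrange (outSum (Λ t) w) a (length R′) (only v w (suc a)) ⟩
      only v w (suc a) + outSum (Λ t) w + (a + suc (length R′))
        ≡⟨ cong (λ l → only v w (suc a) + outSum (Λ t) w + (a + l)) (sym len) ⟩
      only v w (suc a) + outSum (Λ t) w + (a + length R) ∎
      where
      open ℕₚ.≤-Reasoning
      rearrange : ∀ o a r s → o + (suc a + r) + s ≡ s + o + (a + suc r)
      rearrange = solve-∀

  -- No remaining edge enters `v`, so the pending label `a` is all that counts there and it respects
  -- the bound. At other vertices the inequality only gets weaker when the pending label of `v′` is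
  -- dropped.
  jump : ∀ {R v v′ a} → All (Misses v) R → Trail R v′ a → Trail R v a
  jump {R} {v} {v′} {a} v-missed t = record
    { Λ = Λ t ; labels≡ = labels≡ t ; arcs↭ = arcs↭ t ; missed = missed t ; balance = balance′ }
    where
    balance′ : ∀ w → inSum (Λ t) w + only v w a ≤ outSum (Λ t) w + (a + length R)
    balance′ w with v ≟ w
    ... | no _ = ℕₚ.≤-trans (ℕₚ.+-monoʳ-≤ (inSum (Λ t) w) z≤n) (balance t w)
    ... | yes refl rewrite proj₁ (missed t v-missed) =
      ℕₚ.≤-trans (ℕₚ.m≤m+n a (length R)) (ℕₚ.m≤n+m _ (outSum (Λ t) v))

  touch : ∀ v (R : List (Edge n)) →
    (∃[ e ] ∃[ R′ ] ∃[ u ] R ↭ e ∷ R′ × ((v , u) ≡ e ⊎ (v , u) ≡ flip e)) ⊎ All (Misses v) R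
  touch v [] = inj₂ []
  touch v (e@(x , y) ∷ R) with x ≟ v | y ≟ v | touch v R
  ... | yes refl | _ | _ = inj₁ (e , R , y , ↭-refl , inj₁ refl)
  ... | no _ | yes refl | _ = inj₁ (e , R , x , ↭-refl , inj₂ refl)
  ... | no x≢v | no y≢v | inj₂ ms = inj₂ ((x≢v , y≢v) ∷ ms)
  ... | no _ | no _ | inj₁ (f , R′ , u , p , f≡) =
    inj₁ (f , e ∷ R′ , u , ↭-trans (prep e p) (swap e f ↭-refl) , f≡)

  trail : ∀ k R → length R ≡ k → ∀ v a → Trail R v a
  trail zero [] refl v a = record
    { Λ = [] ; labels≡ = refl ; arcs↭ = ↭-refl ; missed = λ _ → refl , refl
    ; balance = λ w → ℕₚ.≤-trans (only-≤ v w a) (ℕₚ.m≤m+n a 0) }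
  trail (suc k) R@((x , y) ∷ R₀) len v a with touch v R
  ... | inj₁ (e , R′ , u , p , e≡) = prepend e p e≡ (trail k R′
          (ℕₚ.suc-injective (≡.trans (sym (Perm.↭-length p)) len)) u (suc a))
  ... | inj₂ ms = jump ms
          (prepend (x , y) ↭-refl (inj₁ refl) (trail k R₀ (ℕₚ.suc-injective len) y (suc a)))

-- Greedy labelling of stars

inSum-++ : ∀ (Λ Λ′ : List (LabelledArc n)) v → inSum (Λ ++ Λ′) v ≡ inSum Λ v + inSum Λ′ v
inSum-++ Λ Λ′ v = ≡.trans (cong sum (map-++ _ Λ Λ′)) (sum-++ (map _ Λ) (map _ Λ′))

outSum-++ : ∀ (Λ Λ′ : List (LabelledArc n)) v → outSum (Λ ++ Λ′) v ≡ outSum Λ v + outSum Λ′ v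
outSum-++ Λ Λ′ v = ≡.trans (cong sum (map-++ _ Λ Λ′)) (sum-++ (map _ Λ) (map _ Λ′))

-- Removing the largest entry `x` from the front of a list lowers its prefix sums of fixed positive
-- length.
sum-take-suc : ∀ {x} j {M} → All (_< x) M → suc j ≤ length M → sum (take (suc j) M) < x + sum (take j M)
sum-take-suc zero (y<x ∷ _) _ = ℕₚ.+-monoˡ-< 0 y<x
sum-take-suc {x} (suc j) {y ∷ M} (_ ∷ M<x) (s≤s len) = begin-strict
  y + sum (take (suc j) M)   <⟨ ℕₚ.+-monoʳ-< y (sum-take-suc j M<x len) ⟩
  y + (x + sum (take j M))   ≡⟨ rearrange y x _ ⟩
  x + (y + sum (take j M))   ∎
  where
  open ℕₚ.≤-Reasoning
  rearrange : ∀ y x s → y + (x + s) ≡ x + (y + s)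
  rearrange = solve-∀

sum-take-drop : ∀ j k {L} → AllPairs ℕ._>_ L → suc k + suc j ≤ length L →
  sum (take (suc j) (drop (suc k) L)) < sum (take (suc j) L)
sum-take-drop j zero {x ∷ M} (x> ∷ _) (s≤s len) = sum-take-suc j x> len
sum-take-drop j (suc k) {x ∷ M} (x> ∷ M>) (s≤s len) = ℕₚ.<-trans
  (sum-take-drop j k M> len) (sum-take-suc j x> (ℕₚ.≤-trans (ℕₚ.m≤n+m (suc j) (suc k)) len))

extract-max : ∀ {A : Set} (f : A → ℤ) x xs →
  ∃[ m ] ∃[ rest ] x ∷ xs ↭ m ∷ rest × All (λ y → f y ℤ.≤ f m) rest
extract-max f x [] = x , [] , ↭-refl , []
extract-max f x (y ∷ ys) with extract-max f y ys
... | m , rest , p , ≤m with ℤₚ.≤-total (f x) (f m)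
...   | inj₁ x≤m = m , x ∷ rest , ↭-trans (prep x p) (swap x m ↭-refl) , x≤m ∷ ≤m
...   | inj₂ m≤x = x , m ∷ rest , prep x p , m≤x ∷ All.map (λ y≤m → ℤₚ.≤-trans y≤m m≤x) ≤m

AllPairs-map-with : ∀ {A : Set} {P : A → Set} {R S : A → A → Set} {xs} →
  (∀ {x y} → P x → P y → R x y → S x y) → All P xs → AllPairs R xs → AllPairs S xs
AllPairs-map-with f [] [] = []
AllPairs-map-with f (px ∷ pxs) (Rx ∷ Rxs) =
  All.zipWith (λ (py , r) → f px py r) (pxs , Rx) ∷ AllPairs-map-with f pxs Rxs

arcs-zip : ∀ (es : List (Edge n)) L → length es ≡ length L → arcs (zip es L) ≡ es
arcs-zip [] [] _ = refl
arcs-zip (e ∷ es) (l ∷ L) eq = cong (e ∷_) (arcs-zip es L (ℕₚ.suc-injective eq))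

labels-zip : ∀ (es : List (Edge n)) L → length es ≡ length L → labels (zip es L) ≡ L
labels-zip [] [] _ = refl
labels-zip (e ∷ es) (l ∷ L) eq = cong (l ∷_) (labels-zip es L (ℕₚ.suc-injective eq))

-- `fibre w` lists the leaves of the star at `w`, and `c w` stands for what the arcs outside the
-- stars contribute to the vertex sum at `w`, with the sign reversed.
module Greedy (fibre : Fin n → List (Fin n)) (c : Fin n → ℤ) where

  star : Fin n → List (Edge n)
  star w = map (w ,_) (fibre w)

  weight : Fin n → ℕ
  weight w = length (fibre w)

  assign : List (Fin n) → List ℕ → List (LabelledArc n)
  assign [] L = []
  assign (w ∷ ws) L = zip (star w) (take (weight w) L) ++ assign ws (drop (weight w) L)

  value : List (Fin n) → List ℕ → Fin n → ℤ
  value ws L w = c w ℤ.+ pos (outSum (assign ws L) w)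

  -- The value of `w` if it is served first; for decreasing `L` this is the best possible.
  bound : List ℕ → Fin n → ℤ
  bound L w = c w ℤ.+ pos (sum (take (weight w) L))

  Fits : List (Fin n) → List ℕ → Set
  Fits ws L = length L ≡ sum (map weight ws)

  fits-take : ∀ w ws {L} → Fits (w ∷ ws) L → length (star w) ≡ length (take (weight w) L)
  fits-take w ws {L} fits = ≡.trans (length-map _ (fibre w)) (sym (≡.trans (length-take (weight w) L)
    (ℕₚ.m≤n⇒m⊓n≡m (subst (weight w ≤_) (sym fits) (ℕₚ.m≤m+n (weight w) (sum (map weight ws)))))))

  fits-drop : ∀ w ws {L} → Fits (w ∷ ws) L → Fits ws (drop (weight w) L)
  fits-drop w ws {L} fits = ≡.trans (length-drop (weight w) L)
    (≡.trans (cong (ℕ._∸ weight w) fits) (ℕₚ.m+n∸m≡n (weight w) (sum (map weight ws))))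

  arcs-assign : ∀ ws {L} → Fits ws L → arcs (assign ws L) ≡ concatMap star ws
  arcs-assign [] _ = refl
  arcs-assign (w ∷ ws) {L} fits = ≡.trans (map-++ proj₁ (zip (star w) _) _)
    (cong₂ _++_ (arcs-zip (star w) _ (fits-take w ws fits)) (arcs-assign ws (fits-drop w ws fits)))

  labels-assign : ∀ ws {L} → Fits ws L → labels (assign ws L) ≡ L
  labels-assign [] {[]} _ = refl
  labels-assign (w ∷ ws) {L} fits = ≡.trans (map-++ proj₂ (zip (star w) _) _)
    (≡.trans (cong₂ _++_ (labels-zip (star w) _ (fits-take w ws fits)) (labels-assign ws (fits-drop w ws fits)))
      (take++drop≡id (weight w) L))

  outSum-star : ∀ w (zs : List (Fin n)) L → length (map (w ,_) zs) ≡ length L → outSum (zip (map (w ,_) zs) L) w ≡ sum L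
  outSum-star w [] [] _ = refl
  outSum-star w (z ∷ zs) (l ∷ L) eq =
    cong₂ _+_ (only-≡ w l) (outSum-star w zs L (ℕₚ.suc-injective eq))

  outSum-other : ∀ {w w′} (zs : List (Fin n)) L → w ≢ w′ → outSum (zip (map (w ,_) zs) L) w′ ≡ 0
  outSum-other [] _ _ = refl
  outSum-other (z ∷ zs) [] _ = refl
  outSum-other (z ∷ zs) (l ∷ L) w≢w′ = cong₂ _+_ (only-≢ l w≢w′) (outSum-other zs L w≢w′)

  outSum-unassigned : ∀ {w} ws L → w ∉ ws → outSum (assign ws L) w ≡ 0
  outSum-unassigned [] _ _ = refl
  outSum-unassigned (w′ ∷ ws) L w∉ = ≡.trans (outSum-++ (zip (star w′) (take (weight w′) L)) (assign ws (drop (weight w′) L)) _)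
    (cong₂ _+_ (outSum-other (fibre w′) (take (weight w′) L) (λ w′≡w → w∉ (here (sym w′≡w))))
      (outSum-unassigned ws (drop (weight w′) L) (w∉ ∘ there)))

  outSum-first : ∀ w {ws L} → Fits (w ∷ ws) L → w ∉ ws →
    outSum (assign (w ∷ ws) L) w ≡ sum (take (weight w) L)
  outSum-first w {ws} {L} fits w∉ = ≡.trans (outSum-++ (zip (star w) (take (weight w) L)) (assign ws (drop (weight w) L)) w)
    (≡.trans (cong₂ _+_ (outSum-star w (fibre w) (take (weight w) L) (fits-take w ws fits)) (outSum-unassigned ws (drop (weight w) L) w∉))
      (ℕₚ.+-identityʳ _))

  outSum-later : ∀ {w w′} ws L → w ≢ w′ →
    outSum (assign (w ∷ ws) L) w′ ≡ outSum (assign ws (drop (weight w) L)) w′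
  outSum-later {w} {w′} ws L w≢w′ = ≡.trans (outSum-++ (zip (star w) (take (weight w) L)) (assign ws (drop (weight w) L)) w′)
    (cong (_+ outSum (assign ws _) w′) (outSum-other (fibre w) (take (weight w) L) w≢w′))

  weight≤sum : ∀ {w ws} → w ∈ ws → weight w ≤ sum (map weight ws)
  weight≤sum {w} {_ ∷ ws} (here refl) = ℕₚ.m≤m+n (weight w) (sum (map weight ws))
  weight≤sum {ws = w′ ∷ ws} (there w∈) = ℕₚ.≤-trans (weight≤sum w∈) (ℕₚ.m≤n+m (sum (map weight ws)) (weight w′))

  -- Once `w` has used up the largest labels, the best ones left for `w′` are smaller. `Fits`
  -- ensures that enough of them are left, and positive weights make the inequality strict.
  bound-drop : ∀ {w w′} ws {L} → AllPairs ℕ._>_ L → Fits (w ∷ ws) L → w′ ∈ ws →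
    0 < weight w → 0 < weight w′ → bound (drop (weight w) L) w′ ℤ.< bound L w′
  bound-drop {w} {w′} ws {L} L> fits w′∈ 0<w 0<w′ = ℤₚ.+-monoʳ-< (c w′)
    (ℤ.+<+ (lemma (weight w) (weight w′) 0<w 0<w′
      (subst (weight w + weight w′ ≤_) (sym fits) (ℕₚ.+-monoʳ-≤ (weight w) (weight≤sum w′∈)))))
    where
    lemma : ∀ k j → 0 < k → 0 < j → k + j ≤ length L → sum (take j (drop k L)) < sum (take j L)
    lemma (suc k) (suc j) _ _ = sum-take-drop j k L>

  -- The vertex that would get the largest value from the largest remaining
  -- labels receives them; afterwards every other bound strictly decreases.
  greedy : ∀ k ws {L} → length ws ≡ k → Unique ws → All (λ w → 0 < weight w) ws →
    AllPairs ℕ._>_ L → Fits ws L →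
    ∃[ ws′ ] ws ↭ ws′ × AllPairs (λ w w′ → value ws′ L w′ ℤ.< value ws′ L w) ws′
      × All (λ w → value ws′ L w ℤ.≤ bound L w) ws′
  greedy zero [] _ _ _ _ _ = [] , ↭-refl , [] , []
  greedy (suc k) (w₀ ∷ ws₀) {L} len ws! ws>0 L> fits with extract-max (bound L) w₀ ws₀
  ... | w , ws , p , ≤w with Unique-resp-↭ p ws! | Perm.All-resp-↭ p ws>0
  ...   | w# ∷ ws!′ | 0<w ∷ ws>0′ with greedy k ws {drop (weight w) L}
            (ℕₚ.suc-injective (≡.trans (sym (Perm.↭-length p)) len)) ws!′ ws>0′
            (AllPairsₚ.drop⁺ (weight w) L>) (fits-drop w ws (≡.trans fits (sum-map-↭ weight p)))
  ...     | ws′ , q , decreasing , bounded = w ∷ ws′ , ↭-trans p (prep w q) ,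
            All.map proj₁ later ∷ AllPairs-map-with (λ w≢x w≢y → subst₂ ℤ._<_ (sym (value-later w≢y)) (sym (value-later w≢x))) w#′ decreasing ,
            ℤₚ.≤-reflexive value-first ∷ All.map proj₂ later
    where
    w#′ : All (w ≢_) ws′
    w#′ = Perm.All-resp-↭ q w#
    fits′ : Fits (w ∷ ws′) L
    fits′ = ≡.trans fits (sum-map-↭ weight (↭-trans p (prep w q)))
    value-first : value (w ∷ ws′) L w ≡ bound L w
    value-first = cong (λ s → c w ℤ.+ pos s) (outSum-first w fits′ (Allₚ.All¬⇒¬Any w#′))
    value-later : ∀ {w′} → w ≢ w′ → value (w ∷ ws′) L w′ ≡ value ws′ (drop (weight w) L) w′
    value-later {w′} w≢w′ = cong (λ s → c w′ ℤ.+ pos s) (outSum-later ws′ L w≢w′)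
    ≤w′ : All (λ y → bound L y ℤ.≤ bound L w) ws′
    ≤w′ = Perm.All-resp-↭ q ≤w
    >0 : All (λ y → 0 < weight y) ws′
    >0 = Perm.All-resp-↭ q ws>0′
    later : All (λ w′ → value (w ∷ ws′) L w′ ℤ.< value (w ∷ ws′) L w
                      × value (w ∷ ws′) L w′ ℤ.≤ bound L w′) ws′
    -- The value of `w′` is at most its bound after the drop, which is less than its bound before;
    -- that is at most the bound of `w`, by the choice of `w`, and `w` attains its bound.
    later = All.tabulate (λ {w′} w′∈ →
      let strict = ℤₚ.≤-<-trans
            (subst (ℤ._≤ bound (drop (weight w) L) w′) (sym (value-later (All.lookup w#′ w′∈)))
              (All.lookup bounded w′∈))
            (bound-drop ws′ L> fits′ w′∈ 0<w (All.lookup >0 w′∈))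
      in subst (value (w ∷ ws′) L w′ ℤ.<_) (sym value-first) (ℤₚ.<-≤-trans strict (All.lookup ≤w′ w′∈))
         , ℤₚ.<⇒≤ strict)

-- Blocks of labels, triples and pairs

-- All three are decreasing. `evens k l` and `odds k l` share out the block of the 2l labels above k
-- alternately.
down evens odds : ℕ → ℕ → List ℕ
down k zero     = []
down k (suc l)  = k + suc l ∷ down k l
evens k zero    = []
evens k (suc l) = k + (suc l + suc l) ∷ evens k l
odds k zero     = []
odds k (suc l)  = k + suc (l + l) ∷ odds k l

upFrom-++ : ∀ k l m → upFrom k (l + m) ≡ upFrom k l ++ upFrom (k + l) m
upFrom-++ k zero m = cong (λ j → upFrom j m) (sym (ℕₚ.+-identityʳ k))
upFrom-++ k (suc l) m = cong (k ∷_) (≡.trans (upFrom-++ (suc k) l m)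
  (cong (λ j → upFrom (suc k) l ++ upFrom j m) (sym (ℕₚ.+-suc k l))))

upFrom-∷ʳ : ∀ k l → upFrom k (suc l) ↭ k + l ∷ upFrom k l
upFrom-∷ʳ k zero = ↭-reflexive (cong (_∷ []) (sym (ℕₚ.+-identityʳ k)))
upFrom-∷ʳ k (suc l) = ↭-trans (prep k (upFrom-∷ʳ (suc k) l))
  (↭-trans (swap k (suc k + l) ↭-refl)
    (↭-reflexive (cong (_∷ k ∷ upFrom (suc k) l) (sym (ℕₚ.+-suc k l)))))

down↭upFrom : ∀ k l → down k l ↭ upFrom (suc k) l
down↭upFrom k zero = ↭-refl
down↭upFrom k (suc l) = ↭-trans (prep _ (down↭upFrom k l))
  (↭-trans (↭-reflexive (cong (_∷ upFrom (suc k) l) (ℕₚ.+-suc k l))) (↭-sym (upFrom-∷ʳ (suc k) l)))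

evens++odds : ∀ k l → evens k l ++ odds k l ↭ down k (l + l)
evens++odds k zero = ↭-refl
evens++odds k (suc l) = ↭-trans (prep _ (Perm.shift _ (evens k l) (odds k l)))
  (↭-trans (prep _ (prep _ (evens++odds k l)))
    (↭-reflexive (cong (λ m → k + (suc l + suc l) ∷ down k m) (sym (ℕₚ.+-suc l l)))))

length-down : ∀ k l → length (down k l) ≡ l
length-down k zero = refl
length-down k (suc l) = cong suc (length-down k l)

length-odds : ∀ k l → length (odds k l) ≡ l
length-odds k zero = refl
length-odds k (suc l) = cong suc (length-odds k l)

down-bounds : ∀ k l → All (λ i → k < i × i ≤ k + l) (down k l)
down-bounds k zero = []
down-bounds k (suc l) = (ℕₚ.m<m+n k (s≤s z≤n) , ℕₚ.≤-refl)
  ∷ All.map (λ (k<i , i≤) → k<i , ℕₚ.≤-trans i≤ (ℕₚ.+-monoʳ-≤ k (ℕₚ.n≤1+n l))) (down-bounds k l)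

odds-bounds : ∀ k l → All (λ i → k < i × i < k + suc (l + l)) (odds k l)
odds-bounds k zero = []
odds-bounds k (suc l) = (ℕₚ.m<m+n k (s≤s z≤n) ,
    ℕₚ.+-monoʳ-< k (s≤s (s≤s (ℕₚ.+-monoʳ-≤ l (ℕₚ.n≤1+n l)))))
  ∷ All.map (λ (k<i , i<) → k<i , ℕₚ.<-trans i<
      (ℕₚ.+-monoʳ-< k (s≤s (s≤s (ℕₚ.+-monoʳ-≤ l (ℕₚ.n≤1+n l)))))) (odds-bounds k l)

down-decreasing : ∀ k l → AllPairs ℕ._>_ (down k l)
down-decreasing k zero = []
down-decreasing k (suc l) =
  All.map (λ (_ , i≤) → ℕₚ.≤-<-trans i≤ (ℕₚ.+-monoʳ-< k ℕₚ.≤-refl)) (down-bounds k l) ∷ down-decreasing k l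

odds-decreasing : ∀ k l → AllPairs ℕ._>_ (odds k l)
odds-decreasing k zero = []
odds-decreasing k (suc l) = All.map proj₂ (odds-bounds k l) ∷ odds-decreasing k l

-- Labels of constant sum on triples and pairs

Triple Pair : ℕ → Set
Triple n = Fin n × Fin n × Fin n × Fin n
Pair n   = Fin n × Fin n × Fin n

tripleArcs : Triple n → List (Edge n)
tripleArcs (z , x , y , t) = (x , z) ∷ (y , z) ∷ (t , z) ∷ []

pairArcs : Pair n → List (Edge n)
pairArcs (z , x , y) = (x , z) ∷ (y , z) ∷ []

-- From one triple to the next the first label falls by 2 while the other two rise by 1, so all
-- triples have the same sum. This is why the first labels are taken from `evens`.
labelTriples : List (Triple n) → (a b c : ℕ) → List (LabelledArc n)
labelTriples [] a b c = []
labelTriples ((z , x , y , t) ∷ ts) a b c =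
  ((x , z) , a + (suc (length ts) + suc (length ts))) ∷ ((y , z) , b) ∷ ((t , z) , c)
  ∷ labelTriples ts a (suc b) (suc c)

labelPairs : List (Pair n) → (a b : ℕ) → List (LabelledArc n)
labelPairs [] a b = []
labelPairs ((z , x , y) ∷ ps) a b =
  ((x , z) , a + suc (length ps)) ∷ ((y , z) , b) ∷ labelPairs ps a (suc b)

arcs-labelTriples : ∀ (ts : List (Triple n)) a b c → arcs (labelTriples ts a b c) ≡ concatMap tripleArcs ts
arcs-labelTriples [] a b c = refl
arcs-labelTriples ((z , x , y , t) ∷ ts) a b c =
  cong (λ es → (x , z) ∷ (y , z) ∷ (t , z) ∷ es) (arcs-labelTriples ts a (suc b) (suc c))

arcs-labelPairs : ∀ (ps : List (Pair n)) a b → arcs (labelPairs ps a b) ≡ concatMap pairArcs ps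
arcs-labelPairs [] a b = refl
arcs-labelPairs ((z , x , y) ∷ ps) a b =
  cong (λ es → (x , z) ∷ (y , z) ∷ es) (arcs-labelPairs ps a (suc b))

labels-labelTriples : ∀ (ts : List (Triple n)) a b c → labels (labelTriples ts a b c) ↭
  evens a (length ts) ++ upFrom b (length ts) ++ upFrom c (length ts)
labels-labelTriples [] a b c = ↭-refl
labels-labelTriples (_ ∷ ts) a b c = prep _ (↭-trans
  (prep b (↭-trans (prep c (↭-trans (labels-labelTriples ts a (suc b) (suc c))
                                    (↭-reflexive (sym (++-assoc ev ub uc)))))
                   (↭-trans (↭-sym (Perm.shift c (ev ++ ub) uc)) (↭-reflexive (++-assoc ev ub (c ∷ uc))))))
  (↭-sym (Perm.shift b ev (ub ++ c ∷ uc))))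
  where
  ev = evens a (length ts)
  ub = upFrom (suc b) (length ts)
  uc = upFrom (suc c) (length ts)

labels-labelPairs : ∀ (ps : List (Pair n)) a b → labels (labelPairs ps a b) ↭
  down a (length ps) ++ upFrom b (length ps)
labels-labelPairs [] a b = ↭-refl
labels-labelPairs (_ ∷ ps) a b = prep _ (↭-trans (prep b (labels-labelPairs ps a (suc b)))
  (↭-sym (Perm.shift b (down a (length ps)) (upFrom (suc b) (length ps)))))

inSum-labelTriples-∉ : ∀ (ts : List (Triple n)) a b c {v} → v ∉ map proj₁ ts →
  inSum (labelTriples ts a b c) v ≡ 0
inSum-labelTriples-∉ [] a b c v∉ = refl
inSum-labelTriples-∉ ((z , _) ∷ ts) a b c {v} v∉
  rewrite only-≢ (a + (suc (length ts) + suc (length ts))) (v∉ ∘ here ∘ sym)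
        | only-≢ b (v∉ ∘ here ∘ sym) | only-≢ c (v∉ ∘ here ∘ sym)
  = inSum-labelTriples-∉ ts a (suc b) (suc c) (v∉ ∘ there)

inSum-labelTriples-∈ : ∀ (ts : List (Triple n)) a b c {v} → Unique (map proj₁ ts) → v ∈ map proj₁ ts →
  inSum (labelTriples ts a b c) v ≡ a + (length ts + length ts) + b + c
inSum-labelTriples-∈ ((z , _) ∷ ts) a b c (z# ∷ _) (here refl)
  rewrite only-≡ z (a + (suc (length ts) + suc (length ts))) | only-≡ z b | only-≡ z c
        | inSum-labelTriples-∉ ts a (suc b) (suc c) (Allₚ.All¬⇒¬Any z#)
  = regroup (a + (suc (length ts) + suc (length ts))) b c
  where
  regroup : ∀ i b c → i + (b + (c + 0)) ≡ i + b + c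
  regroup = solve-∀
inSum-labelTriples-∈ ((z , _) ∷ ts) a b c {v} (z# ∷ ts!) (there v∈)
  rewrite only-≢ (a + (suc (length ts) + suc (length ts))) (All.lookup z# v∈)
        | only-≢ b (All.lookup z# v∈) | only-≢ c (All.lookup z# v∈)
  = ≡.trans (inSum-labelTriples-∈ ts a (suc b) (suc c) ts! v∈) (shift-labels a (length ts) b c)
  where
  shift-labels : ∀ a l b c → a + (l + l) + suc b + suc c ≡ a + (suc l + suc l) + b + c
  shift-labels = solve-∀

-- Within a pair one label falls by 1 when the other rises by 1, so all pairs have the same sum, and
-- `k` is the number of pairs at `v`.
inSum-labelPairs : ∀ (ps : List (Pair n)) a b v →
  ∃[ k ] inSum (labelPairs ps a b) v ≡ k * (a + length ps + b)
inSum-labelPairs [] a b v = 0 , refl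
inSum-labelPairs ((z , _) ∷ ps) a b v with z ≟ v | inSum-labelPairs ps a (suc b) v
... | yes refl | k , eq = suc k , ≡.trans
  (cong (λ i → a + suc (length ps) + (b + i)) eq) (regroup a (length ps) b k)
  where
  regroup : ∀ a l b k → a + suc l + (b + k * (a + l + suc b)) ≡ suc k * (a + suc l + b)
  regroup = solve-∀
... | no _ | k , eq = k , ≡.trans eq (cong (k *_) (shift-labels a (length ps) b))
  where
  shift-labels : ∀ a l b → a + l + suc b ≡ a + suc l + b
  shift-labels = solve-∀

-- Splitting the edges at a vertex into pairs and triples

flatten : ∀ {A : Set} → List (A × A) → List A
flatten = concatMap (λ (x , y) → x ∷ y ∷ [])

halve : ∀ {A : Set} (xs : List A) → ∃[ ps ] (xs ≡ flatten ps ⊎ ∃[ x ] xs ≡ x ∷ flatten ps)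
halve [] = [] , inj₁ refl
halve (x ∷ xs) with halve xs
... | ps , inj₁ refl = ps , inj₂ (x , refl)
... | ps , inj₂ (y , refl) = (x , y) ∷ ps , inj₁ refl

into : Fin n → List (Fin n) → List (Edge n)
into z = map (_, z)

into-pairs : ∀ (z : Fin n) ps → into z (flatten ps) ≡ concatMap pairArcs (map (z ,_) ps)
into-pairs z [] = refl
into-pairs z ((x , y) ∷ ps) = cong (λ es → (x , z) ∷ (y , z) ∷ es) (into-pairs z ps)

-- Vertices of even degree carry one triple, besides their chosen edge and pairs.
record Decomposition (zs : List (Fin n)) (es : List (Edge n)) : Set where
  field
    triples  : List (Triple n)
    pairs    : List (Pair n)
    plain    : ℕ
    triples! : Unique zs → Unique (map proj₁ triples)
    triples⊆ : ∀ {z} → z ∈ map proj₁ triples → z ∈ zs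
    counts   : length zs ≡ plain + length triples
    es↭      : es ↭ concatMap tripleArcs triples ++ concatMap pairArcs pairs

-- If `rest z` has odd length, it has at least three entries, its length not being 1; the first
-- three form the triple, and an even number is left for the pairs.
decompose : ∀ (rest : Fin n → List (Fin n)) → (∀ z → length (rest z) ≢ 1) → ∀ zs →
  Decomposition zs (concatMap (λ z → into z (rest z)) zs)
decompose rest ≢1 [] = record
  { triples = [] ; pairs = [] ; plain = 0 ; triples! = λ _ → [] ; triples⊆ = λ () ; counts = refl ; es↭ = ↭-refl }
decompose rest ≢1 (z ∷ zs) with decompose rest ≢1 zs | rest z | ≢1 z | halve (rest z)
... | d | _ | _ | ps , inj₁ refl = record
  { triples = triples ; pairs = map (z ,_) ps ++ pairs ; plain = suc plain
  ; triples! = λ { (_ ∷ zs!) → triples! zs! } ; triples⊆ = there ∘ triples⊆ ; counts = cong suc counts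
  ; es↭ = ↭-trans (Perm.++⁺ (↭-reflexive (into-pairs z ps)) es↭)
      (↭-trans (Perm.shifts (concatMap pairArcs (map (z ,_) ps)) (concatMap tripleArcs triples))
        (Perm.++⁺ˡ (concatMap tripleArcs triples)
          (↭-reflexive (sym (concatMap-++ pairArcs (map (z ,_) ps) pairs)))))
  } where open Decomposition d
... | d | _ | ≢1z | [] , inj₂ (x , refl) = ⊥-elim (≢1z refl)
... | d | _ | _ | (y , t) ∷ ps , inj₂ (x , refl) = record
  { triples = (z , x , y , t) ∷ triples ; pairs = map (z ,_) ps ++ pairs ; plain = plain
  ; triples! = λ { (z# ∷ zs!) → fresh (λ z∈ → Allₚ.All¬⇒¬Any z# (triples⊆ z∈)) ∷ triples! zs! }
  ; triples⊆ = λ { (here eq) → here eq ; (there z∈) → there (triples⊆ z∈) }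
  ; counts = ≡.trans (cong suc counts) (sym (ℕₚ.+-suc plain (length triples)))
  ; es↭ = prep _ (prep _ (prep _ (↭-trans (Perm.++⁺ (↭-reflexive (into-pairs z ps)) es↭)
      (↭-trans (Perm.shifts (concatMap pairArcs (map (z ,_) ps)) (concatMap tripleArcs triples))
        (Perm.++⁺ˡ (concatMap tripleArcs triples)
          (↭-reflexive (sym (concatMap-++ pairArcs (map (z ,_) ps) pairs))))))))
  } where open Decomposition d

-- The blocks from bottom to top: `s` inner labels; `o` labels of chosen edges; `e + e` labels
-- alternating between chosen edges and triples; the lower labels of the pairs; the second labels of
-- the triples; the upper labels of the pairs; the third labels of the triples.
labels-total : ∀ s o e p → let x = s + o + (e + e) in
  upFrom 1 s ++ (odds (s + o) e ++ down s o)
    ++ (evens (s + o) e ++ upFrom (suc (x + p)) e ++ upFrom (suc (x + p + e + p)) e)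
    ++ (down x p ++ upFrom (suc (x + p + e)) p)
  ↭ upFrom 1 (x + p + e + p + e)
labels-total s o e p = begin
  W ++ (O ++ D) ++ (E ++ B ++ C) ++ (L ++ H)
    ↭⟨ solve 8 (λ W O D E B C L H →
         W ⊕ ((O ⊕ D) ⊕ ((E ⊕ (B ⊕ C)) ⊕ (L ⊕ H))) ⊜ (((((W ⊕ D) ⊕ (E ⊕ O)) ⊕ L) ⊕ B) ⊕ H) ⊕ C)
         ↭-refl W O D E B C L H ⟩
  (((((W ++ D) ++ (E ++ O)) ++ L) ++ B) ++ H) ++ C
    ↭⟨ Perm.++⁺ʳ C (Perm.++⁺ʳ H (Perm.++⁺ʳ B (Perm.++⁺ (Perm.++⁺ (Perm.++⁺ˡ W (down↭upFrom s o))
         (↭-trans (evens++odds (s + o) e) (down↭upFrom (s + o) (e + e)))) (down↭upFrom x p)))) ⟩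
  (((((W ++ upFrom (1 + s) o) ++ upFrom (1 + (s + o)) (e + e)) ++ upFrom (1 + x) p) ++ B) ++ H) ++ C
    ≡⟨ cong (λ K → ((((K ++ upFrom (1 + (s + o)) (e + e)) ++ upFrom (1 + x) p) ++ B) ++ H) ++ C)
         (upFrom-++ 1 s o) ⟨
  ((((upFrom 1 (s + o) ++ upFrom (1 + (s + o)) (e + e)) ++ upFrom (1 + x) p) ++ B) ++ H) ++ C
    ≡⟨ cong (λ K → (((K ++ upFrom (1 + x) p) ++ B) ++ H) ++ C) (upFrom-++ 1 (s + o) (e + e)) ⟨
  (((upFrom 1 x ++ upFrom (1 + x) p) ++ B) ++ H) ++ C
    ≡⟨ cong (λ K → ((K ++ B) ++ H) ++ C) (upFrom-++ 1 x p) ⟨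
  ((upFrom 1 (x + p) ++ B) ++ H) ++ C
    ≡⟨ cong (λ K → (K ++ H) ++ C) (upFrom-++ 1 (x + p) e) ⟨
  (upFrom 1 (x + p + e) ++ H) ++ C
    ≡⟨ cong (_++ C) (upFrom-++ 1 (x + p + e) p) ⟨
  upFrom 1 (x + p + e + p) ++ C
    ≡⟨ upFrom-++ 1 (x + p + e + p) e ⟨
  upFrom 1 (x + p + e + p + e) ∎
  where
  open PermutationReasoning
  open CommutativeMonoidSolver (Perm.++-commutativeMonoid {A = ℕ}) using (solve; _⊕_; _⊜_)
  x = s + o + (e + e)
  W = upFrom 1 s
  O = odds (s + o) e
  D = down s o
  E = evens (s + o) e
  B = upFrom (suc (x + p)) e
  C = upFrom (suc (x + p + e + p)) e
  L = down x p
  H = upFrom (suc (x + p + e)) p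

%-unique : ∀ {M r r′} k k′ → r < M → r′ < M → r + k * M ≡ r′ + k′ * M → r ≡ r′
%-unique {suc M} {r} {r′} k k′ r< r′< eq = begin
  r                          ≡⟨ m<n⇒m%n≡m r< ⟨
  r % suc M                  ≡⟨ [m+kn]%n≡m%n r k (suc M) ⟨
  (r + k * suc M) % suc M    ≡⟨ cong (_% suc M) eq ⟩
  (r′ + k′ * suc M) % suc M  ≡⟨ [m+kn]%n≡m%n r′ k′ (suc M) ⟩
  r′ % suc M                 ≡⟨ m<n⇒m%n≡m r′< ⟩
  r′                         ∎
  where open ≡-Reasoning

-- The antimagic orientation

length-filter-T : ∀ {m} (p : Fin n → Bool) (f : Fin m → Fin n) →
  length (filter (T? ∘ p) (tabulate f)) ≡ count (p ∘ f)
length-filter-T {m = zero} p f = refl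
length-filter-T {m = suc m} p f with p (f zero)
... | true = cong suc (length-filter-T p (f ∘ suc))
... | false = length-filter-T p (f ∘ suc)

count-none : ∀ (p : Fin n → Bool) → (∀ v → ¬ T (p v)) → count p ≡ 0
count-none {zero} p none = refl
count-none {suc n} p none with p zero | none zero
... | true | ¬p = ⊥-elim (¬p _)
... | false | _ = count-none (p ∘ suc) (none ∘ suc)

-- `key` recovers from an entry the block that it comes from, so blocks of distinct elements are
-- disjoint.
Unique-concatMap : ∀ {A B : Set} (key : B → A) (h : A → List B) → (∀ x → Unique (h x)) →
  (∀ {x y} → y ∈ h x → key y ≡ x) → ∀ {xs} → Unique xs → Unique (concatMap h xs)
Unique-concatMap key h h! key≡ [] = []
Unique-concatMap key h h! key≡ {x ∷ xs} (x# ∷ xs!) =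
  Uniqueₚ.++⁺ (h! x) (Unique-concatMap key h h! key≡ xs!) λ (y∈hx , y∈rest) →
    case find (∈-concatMap⁻ h y∈rest) of λ (x′ , x′∈ , y∈hx′) →
      All.lookup x# x′∈ (≡.trans (sym (key≡ y∈hx)) (key≡ y∈hx′))

Unique-map-on : ∀ {A B : Set} (f : A → B) {xs} → (∀ {x y} → x ∈ xs → y ∈ xs → f x ≡ f y → x ≡ y) →
  Unique xs → Unique (map f xs)
Unique-map-on f inj xs! = AllPairsₚ.map⁺
  (AllPairs-map-with (λ x∈ y∈ x≢y eq → x≢y (inj x∈ y∈ eq)) (All.tabulate id) xs!)

set-↭ : ∀ {A : Set} {xs ys : List A} → Unique xs → Unique ys →
  (∀ {x} → x ∈ xs → x ∈ ys) → (∀ {x} → x ∈ ys → x ∈ xs) → xs ↭ ys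
set-↭ xs! ys! to from = ∼bag⇒↭ (unique∧set⇒bag xs! ys! (mk⇔ to from))

concatMap-∷-↭ : ∀ {A B : Set} (f g : A → List B) (h : A → B) → (∀ x → f x ↭ h x ∷ g x) → ∀ xs →
  concatMap f xs ↭ map h xs ++ concatMap g xs
concatMap-∷-↭ f g h p [] = ↭-refl
concatMap-∷-↭ f g h p (x ∷ xs) = ↭-trans (Perm.++⁺ (p x) (concatMap-∷-↭ f g h p xs))
  (prep (h x) (Perm.shifts (g x) (map h xs)))

concatMap-↭ : ∀ {A B : Set} (f : A → List B) {xs ys} → xs ↭ ys → concatMap f xs ↭ concatMap f ys
concatMap-↭ f _↭_.refl = ↭-refl
concatMap-↭ f (prep x q) = Perm.++⁺ˡ (f x) (concatMap-↭ f q)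
concatMap-↭ f (swap x y q) = ↭-trans (Perm.shifts (f x) (f y))
  (Perm.++⁺ˡ (f y) (Perm.++⁺ˡ (f x) (concatMap-↭ f q)))
concatMap-↭ f (_↭_.trans q r) = ↭-trans (concatMap-↭ f q) (concatMap-↭ f r)

length-concatMap : ∀ {A B : Set} (f : A → List B) xs → length (concatMap f xs) ≡ sum (map (length ∘ f) xs)
length-concatMap f [] = refl
length-concatMap f (x ∷ xs) = ≡.trans (length-++ (f x)) (cong (length (f x) +_) (length-concatMap f xs))

inSum-absent : ∀ (Λ : List (LabelledArc n)) {v} → (∀ {e} → e ∈ arcs Λ → proj₂ e ≢ v) → inSum Λ v ≡ 0
inSum-absent [] _ = refl
inSum-absent (_ ∷ Λ) ≢v = cong₂ _+_ (only-≢ _ (≢v (here refl))) (inSum-absent Λ (≢v ∘ there))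

outSum-absent : ∀ (Λ : List (LabelledArc n)) {v} → (∀ {e} → e ∈ arcs Λ → proj₁ e ≢ v) → outSum Λ v ≡ 0
outSum-absent [] _ = refl
outSum-absent (_ ∷ Λ) ≢v = cong₂ _+_ (only-≢ _ (≢v (here refl))) (outSum-absent Λ (≢v ∘ there))

inSum-unique : ∀ (Λ : List (LabelledArc n)) {u v l} → Unique (map proj₂ (arcs Λ)) →
  ((u , v) , l) ∈ Λ → inSum Λ v ≡ l
inSum-unique (_ ∷ Λ) {v = v} {l} (v# ∷ _) (here refl) = ≡.trans
  (cong₂ _+_ (only-≡ v l) (inSum-absent Λ (λ e∈ e≡v → Allₚ.All¬⇒¬Any v# (subst (_∈ map proj₂ (arcs Λ)) e≡v (∈-map⁺ proj₂ e∈)))))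
  (ℕₚ.+-identityʳ l)
inSum-unique (((_ , b) , k) ∷ Λ) {v = v} (b# ∷ Λ!) (there ∈Λ) = cong₂ _+_
  (only-≢ k (All.lookup b# (∈-map⁺ proj₂ (∈-map⁺ proj₁ ∈Λ)))) (inSum-unique Λ Λ! ∈Λ)

label≤outSum : ∀ (Λ : List (LabelledArc n)) {u v l} → ((u , v) , l) ∈ Λ → l ≤ outSum Λ u
label≤outSum (_ ∷ Λ) {u} {l = l} (here refl) rewrite only-≡ u l = ℕₚ.m≤m+n l (outSum Λ u)
label≤outSum (_ ∷ Λ) (there ∈Λ) = ℕₚ.≤-trans (label≤outSum Λ ∈Λ) (ℕₚ.m≤n+m _ _)

-- A canonical direction for each edge, so that arc lists can be compared although trails may
-- reverse edges.
sorted : Edge n → Edge n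
sorted (u , v) with <-cmp u v
... | tri> _ _ _ = v , u
... | _          = u , v

sorted-flip : ∀ (e : Edge n) → sorted (flip e) ≡ sorted e
sorted-flip (u , v) with <-cmp u v | <-cmp v u
... | tri< _ _ _ | tri> _ _ _ = refl
... | tri> _ _ _ | tri< _ _ _ = refl
... | tri≈ _ refl _ | tri< _ _ _ = refl
... | tri≈ _ refl _ | tri≈ _ _ _ = refl
... | tri≈ _ refl _ | tri> _ _ _ = refl
... | tri< u<v _ _ | tri< _ _ u≯v = ⊥-elim (u≯v u<v)
... | tri< _ u≢v _ | tri≈ _ v≡u _ = ⊥-elim (u≢v (sym v≡u))
... | tri> _ u≢v _ | tri≈ _ v≡u _ = ⊥-elim (u≢v (sym v≡u))
... | tri> u≮v _ _ | tri> _ _ u<v = ⊥-elim (u≮v u<v)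

sorted-either : ∀ (e : Edge n) → sorted e ≡ e ⊎ sorted e ≡ flip e
sorted-either (u , v) with <-cmp u v
... | tri< _ _ _ = inj₁ refl
... | tri≈ _ _ _ = inj₁ refl
... | tri> _ _ _ = inj₂ refl

sorted-≡ : ∀ {e f : Edge n} → sorted e ≡ sorted f → e ≡ f ⊎ e ≡ flip f
sorted-≡ {e = e} {f} eq with sorted-either e | sorted-either f
... | inj₁ p | inj₁ q = inj₁ (≡.trans (sym p) (≡.trans eq q))
... | inj₁ p | inj₂ q = inj₂ (≡.trans (sym p) (≡.trans eq q))
... | inj₂ p | inj₁ q = inj₂ (cong flip (≡.trans (sym p) (≡.trans eq q)))
... | inj₂ p | inj₂ q = inj₁ (cong flip (≡.trans (sym p) (≡.trans eq q)))

excess-++ : ∀ (Λ Λ′ : List (LabelledArc n)) v →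
  excess (Λ ++ Λ′) v ≡ pos (inSum Λ v + inSum Λ′ v) ℤ.- pos (outSum Λ v + outSum Λ′ v)
excess-++ Λ Λ′ v = cong₂ (λ i o → pos i ℤ.- pos o) (inSum-++ Λ Λ′ v) (outSum-++ Λ Λ′ v)

sorted-transfer : ∀ {es fs : List (Edge n)} → map sorted es ↭ map sorted fs →
  ∀ {u v} → (u , v) ∈ es → (u , v) ∈ fs ⊎ (v , u) ∈ fs
sorted-transfer p uv∈ with ∈-map⁻ sorted (Perm.∈-resp-↭ p (∈-map⁺ sorted uv∈))
... | _ , f∈ , eq with sorted-≡ eq
...   | inj₁ refl = inj₁ f∈
...   | inj₂ refl = inj₂ f∈

∈arcs⁻ : ∀ (Λ : List (LabelledArc n)) {f} → f ∈ arcs Λ → ∃[ l ] (f , l) ∈ Λ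
∈arcs⁻ Λ f∈ with ∈-map⁻ proj₁ f∈
... | (_ , l) , ∈Λ , refl = l , ∈Λ

-- The labelled orientation obtained from a star cover

module Construction (G : Graph n) (S : StarCover G) (degree≢2 : ∀ v → Graph.degree G v ≢ 2) (v₀ : Fin n) where
  open Graph G
  open StarCover S

  ws zs : List (Fin n)
  ws = filter W? (allFin n)
  zs = filter (¬? ∘ W?) (allFin n)

  ws! : Unique ws
  ws! = Uniqueₚ.filter⁺ W? (Uniqueₚ.allFin⁺ n)

  zs! : Unique zs
  zs! = Uniqueₚ.filter⁺ (¬? ∘ W?) (Uniqueₚ.allFin⁺ n)

  W⇒∈ws : ∀ {w} → W w → w ∈ ws
  W⇒∈ws {w} = ∈-filter⁺ W? (∈-allFin w)

  ∈ws⇒W : ∀ {w} → w ∈ ws → W w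
  ∈ws⇒W = proj₂ ∘ ∈-filter⁻ W? {xs = allFin n}

  ¬W⇒∈zs : ∀ {z} → ¬ W z → z ∈ zs
  ¬W⇒∈zs {z} = ∈-filter⁺ (¬? ∘ W?) (∈-allFin z)

  ∈zs⇒¬W : ∀ {z} → z ∈ zs → ¬ W z
  ∈zs⇒¬W = proj₂ ∘ ∈-filter⁻ (¬? ∘ W?) {xs = allFin n}

  neighbours : Fin n → List (Fin n)
  neighbours v = filter (T? ∘ adj v) (allFin n)

  neighbours! : ∀ v → Unique (neighbours v)
  neighbours! v = Uniqueₚ.filter⁺ (T? ∘ adj v) (Uniqueₚ.allFin⁺ n)

  Adj⇒∈ : ∀ {u v} → Adj v u → u ∈ neighbours v
  Adj⇒∈ {u} {v} = ∈-filter⁺ (T? ∘ adj v) (∈-allFin u)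

  ∈⇒Adj : ∀ {u v} → u ∈ neighbours v → Adj v u
  ∈⇒Adj {v = v} = proj₂ ∘ ∈-filter⁻ (T? ∘ adj v) {xs = allFin n}

  others : ∀ z → ∃[ rest ] neighbours z ↭ centre z ∷ rest
  others z with ∈-∃++ (Adj⇒∈ (symmetric (centre-adj z)))
  ... | as , bs , eq = as ++ bs , ↭-trans (↭-reflexive eq) (Perm.shift (centre z) as bs)

  rest : Fin n → List (Fin n)
  rest z = proj₁ (others z)

  rest≢1 : ∀ z → length (rest z) ≢ 1
  rest≢1 z eq = degree≢2 z (≡.trans (sym (length-filter-T (adj z) (λ v → v)))
    (≡.trans (Perm.↭-length (proj₂ (others z))) (cong suc eq)))

  open Decomposition (decompose rest rest≢1 zs)

  -- Restricting to smaller neighbours lists each edge inside `W` once.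
  below : Fin n → List (Fin n)
  below v = filter (λ u → W? u ×-dec (u Finₚ.<? v)) (neighbours v)

  inner outer : List (Edge n)
  inner = concatMap (λ v → into v (below v)) ws
  outer = concatMap (λ z → into z (neighbours z)) zs

  ∈inner⁻ : ∀ {u v} → (u , v) ∈ inner → (W u × W v) × u Fin.< v × Adj u v
  ∈inner⁻ uv∈ with find (∈-concatMap⁻ (λ v → into v (below v)) {ws} uv∈)
  ... | v , v∈ , uv∈′ with ∈-map⁻ (_, v) uv∈′
  ...   | u , u∈ , refl with ∈-filter⁻ (λ u → W? u ×-dec (u Finₚ.<? v)) {xs = neighbours v} u∈
  ...     | u∈′ , Wu , u<v = (Wu , ∈ws⇒W v∈) , u<v , symmetric (∈⇒Adj u∈′)

  ∈inner⁺ : ∀ {u v} → W u → W v → u Fin.< v → Adj u v → (u , v) ∈ inner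
  ∈inner⁺ {u} {v} Wu Wv u<v uv = ∈-concatMap⁺ (λ v → into v (below v)) (lose (W⇒∈ws Wv)
    (∈-map⁺ (_, v) (∈-filter⁺ (λ u → W? u ×-dec (u Finₚ.<? v)) (Adj⇒∈ (symmetric uv)) (Wu , u<v))))

  ∈outer⁻ : ∀ {u v} → (u , v) ∈ outer → (W u × ¬ W v) × Adj u v
  ∈outer⁻ uv∈ with find (∈-concatMap⁻ (λ z → into z (neighbours z)) {zs} uv∈)
  ... | v , v∈ , uv∈′ with ∈-map⁻ (_, v) uv∈′
  ...   | u , u∈ , refl = (cover (∈⇒Adj u∈) (∈zs⇒¬W v∈) , ∈zs⇒¬W v∈) , symmetric (∈⇒Adj u∈)

  ∈outer⁺ : ∀ {u v} → ¬ W v → Adj u v → (u , v) ∈ outer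
  ∈outer⁺ {u} {v} ¬Wv uv = ∈-concatMap⁺ (λ z → into z (neighbours z)) (lose (¬W⇒∈zs ¬Wv)
    (∈-map⁺ (_, v) (Adj⇒∈ (symmetric uv))))

  into-key : ∀ {v : Fin n} {us} {e : Edge n} → e ∈ into v us → proj₂ e ≡ v
  into-key e∈ with ∈-map⁻ _ e∈
  ... | _ , _ , refl = refl

  into! : ∀ (v : Fin n) {us} → Unique us → Unique (into v us)
  into! v = Uniqueₚ.map⁺ (cong proj₁)

  edges : List (Edge n)
  edges = inner ++ outer

  edges! : Unique edges
  edges! = Uniqueₚ.++⁺
    (Unique-concatMap proj₂ _ (λ v → into! v (Uniqueₚ.filter⁺ _ (neighbours! v))) into-key ws!)
    (Unique-concatMap proj₂ _ (λ z → into! z (neighbours! z)) into-key zs!)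
    (λ (e∈ , e∈′) → proj₂ (proj₁ (∈outer⁻ e∈′)) (proj₂ (proj₁ (∈inner⁻ e∈))))

  tail-W : ∀ {u v} → (u , v) ∈ edges → W u
  tail-W e∈ with ∈-++⁻ inner e∈
  ... | inj₁ e∈′ = proj₁ (proj₁ (∈inner⁻ e∈′))
  ... | inj₂ e∈′ = proj₁ (proj₁ (∈outer⁻ e∈′))

  edges-Adj : ∀ {u v} → (u , v) ∈ edges → Adj u v
  edges-Adj e∈ with ∈-++⁻ inner e∈
  ... | inj₁ e∈′ = proj₂ (proj₂ (∈inner⁻ e∈′))
  ... | inj₂ e∈′ = proj₂ (∈outer⁻ e∈′)

  inside : ∀ {u v} → (u , v) ∈ edges → W v → u Fin.< v
  inside e∈ Wv with ∈-++⁻ inner e∈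
  ... | inj₁ e∈′ = proj₁ (proj₂ (∈inner⁻ e∈′))
  ... | inj₂ e∈′ = ⊥-elim (proj₂ (proj₁ (∈outer⁻ e∈′)) Wv)

  -- Tails are in `W`, so if both directions occurred both ends would be in `W`, and each end would
  -- be smaller than the other.
  flip∉edges : ∀ {u v} → (u , v) ∈ edges → (v , u) ∉ edges
  flip∉edges e∈ f∈ = Finₚ.<-asym (inside e∈ (tail-W f∈)) (inside f∈ (tail-W e∈))

  edges-complete : ∀ {u v} → Adj u v → (u , v) ∈ edges ⊎ (v , u) ∈ edges
  edges-complete {u} {v} uv with W? u | W? v | <-cmp u v
  ... | _ | no ¬Wv | _ = inj₁ (∈-++⁺ʳ inner (∈outer⁺ ¬Wv uv))
  ... | no ¬Wu | yes _ | _ = inj₂ (∈-++⁺ʳ inner (∈outer⁺ ¬Wu (symmetric uv)))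
  ... | yes Wu | yes Wv | tri< u<v _ _ = inj₁ (∈-++⁺ˡ (∈inner⁺ Wu Wv u<v uv))
  ... | yes _ | yes _ | tri≈ _ u≡v _ = ⊥-elim (loopless u≡v uv)
  ... | yes Wu | yes Wv | tri> _ _ v<u = inj₂ (∈-++⁺ˡ (∈inner⁺ Wv Wu v<u (symmetric uv)))

  sorted-edges! : Unique (map sorted edges)
  sorted-edges! = Unique-map-on sorted (λ e∈ f∈ eq → case sorted-≡ eq of λ
    { (inj₁ e≡f) → e≡f ; (inj₂ refl) → ⊥-elim (flip∉edges f∈ e∈) }) edges!

  chosen : List (Edge n)
  chosen = map (λ z → centre z , z) zs

  fibre : Fin n → List (Fin n)
  fibre w = filter (λ z → centre z ≟ w) zs

  outer↭ : outer ↭ chosen ++ concatMap tripleArcs triples ++ concatMap pairArcs pairs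
  outer↭ = ↭-trans (concatMap-∷-↭ _ (λ z → into z (rest z)) _ (λ z → Perm.map⁺ (_, z) (proj₂ (others z))) zs)
    (Perm.++⁺ˡ chosen es↭)

  -- In order: the number of inner edges, of vertices outside `W` without a triple, of those with a
  -- triple, and of pairs; then an upper bound on the chosen labels, and the common sum of the
  -- pairs.
  s o e p x M : ℕ
  s = length inner
  o = plain
  e = length triples
  p = length pairs
  x = s + o + (e + e)
  M = x + p + suc (x + p + e)

  open TrailLabelling (sorted {n}) sorted-flip using (Trail; trail)
  -- The trail may start anywhere: a pending label 0 at `v₀` adds nothing to the balance, and the
  -- labels used are 1 to `s`.
  open Trail (trail s inner refl v₀ 0) using (labels≡; arcs↭; missed; balance)
    renaming (Λ to Λ-inner)

  Λ-triples Λ-pairs : List (LabelledArc n)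
  Λ-triples = labelTriples triples (s + o) (suc (x + p)) (suc (x + p + e + p))
  Λ-pairs   = labelPairs pairs x (suc (x + p + e))

  -- For `w` in `W` only inner arcs enter `w`, so only their labels are subtracted.
  c : Fin n → ℤ
  c w = pos (outSum Λ-inner w + (outSum Λ-triples w + outSum Λ-pairs w)) ℤ.- pos (inSum Λ-inner w)

  open Greedy fibre c

  star-key : ∀ {w f} → f ∈ star w → proj₁ f ≡ w
  star-key f∈ with ∈-map⁻ _ f∈
  ... | _ , _ , refl = refl

  ∈star⁻ : ∀ {w f} → f ∈ star w → f ∈ chosen
  ∈star⁻ {w} f∈ with ∈-map⁻ (w ,_) f∈
  ... | z , z∈ , refl with ∈-filter⁻ (λ z → centre z ≟ w) {xs = zs} z∈
  ...   | z∈zs , refl = ∈-map⁺ (λ z → centre z , z) z∈zs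

  ∈fibre : ∀ {z} → z ∈ zs → z ∈ fibre (centre z)
  ∈fibre {z} z∈ = ∈-filter⁺ (λ z′ → centre z′ ≟ centre z) z∈ refl

  centre-W : ∀ {z} → z ∈ zs → W (centre z)
  centre-W {z} z∈ = cover (symmetric (centre-adj z)) (∈zs⇒¬W z∈)

  stars↭chosen : concatMap star ws ↭ chosen
  stars↭chosen = set-↭
    (Unique-concatMap proj₁ star
      (λ w → Uniqueₚ.map⁺ (cong proj₂) (Uniqueₚ.filter⁺ (λ z → centre z ≟ w) zs!)) star-key ws!)
    (Uniqueₚ.map⁺ (cong proj₂) zs!)
    (λ f∈ → let (_ , _ , f∈star) = find (∈-concatMap⁻ star {ws} f∈) in ∈star⁻ f∈star)
    (λ f∈ → case ∈-map⁻ (λ z → centre z , z) f∈ of λ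
      { (z , z∈ , refl) → ∈-concatMap⁺ star
          (lose (W⇒∈ws (centre-W z∈)) (∈-map⁺ (centre z ,_) (∈fibre z∈))) })

  -- The labels for the chosen edges, in decreasing order as `greedy` requires; the gaps above
  -- `s + o` are filled by the triples.
  L : List ℕ
  L = odds (s + o) e ++ down s o

  L-decreasing : AllPairs ℕ._>_ L
  L-decreasing = AllPairsₚ.++⁺ (odds-decreasing (s + o) e) (down-decreasing s o)
    (All.map (λ (s+o<i , _) → All.map (λ (_ , j≤) → ℕₚ.≤-<-trans j≤ s+o<i) (down-bounds s o))
      (odds-bounds (s + o) e))

  L! : Unique L
  L! = AllPairs.map (λ i>j i≡j → ℕₚ.<⇒≢ i>j (sym i≡j)) L-decreasing

  L-bounds : All (λ i → s < i × i ≤ x) L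
  L-bounds = Allₚ.++⁺
    (All.map (λ {i} (s+o<i , i<) → ℕₚ.≤-<-trans (ℕₚ.m≤m+n s o) s+o<i ,
      ℕₚ.≤-pred (subst (suc i ≤_) (ℕₚ.+-suc (s + o) (e + e)) i<)) (odds-bounds (s + o) e))
    (All.map (λ (s<i , i≤) → s<i , ℕₚ.≤-trans i≤ (ℕₚ.m≤m+n (s + o) (e + e))) (down-bounds s o))

  fits : Fits ws L
  fits = begin
    length L                     ≡⟨ length-++ (odds (s + o) e) ⟩
    _                            ≡⟨ cong₂ _+_ (length-odds (s + o) e) (length-down s o) ⟩
    e + o                        ≡⟨ ℕₚ.+-comm e o ⟩
    o + e                        ≡⟨ counts ⟨
    length zs                    ≡⟨ length-map _ zs ⟨
    length chosen                ≡⟨ Perm.↭-length stars↭chosen ⟨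
    length (concatMap star ws)   ≡⟨ length-concatMap star ws ⟩
    sum (map (length ∘ star) ws) ≡⟨ cong sum (map-cong (λ w → length-map (w ,_) (fibre w)) ws) ⟩
    sum (map weight ws)          ∎
    where open ≡-Reasoning

  weights>0 : All (λ w → 0 < weight w) ws
  weights>0 = All.tabulate (λ w∈ → case centre-onto (∈ws⇒W w∈) of λ
    { (z , ¬Wz , refl) → ∈-length (∈fibre (¬W⇒∈zs ¬Wz)) })

  order : ∃[ ws′ ] ws ↭ ws′ × AllPairs (λ w w′ → value ws′ L w′ ℤ.< value ws′ L w) ws′
      × All (λ w → value ws′ L w ℤ.≤ bound L w) ws′
  order = greedy (length ws) ws refl ws! weights>0 L-decreasing fits

  ws′ : List (Fin n)
  ws′ = proj₁ order

  ws↭ws′ : ws ↭ ws′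
  ws↭ws′ = proj₁ (proj₂ order)

  Λ-chosen Λ-outer Λ : List (LabelledArc n)
  Λ-chosen = assign ws′ L
  Λ-outer  = Λ-chosen ++ Λ-triples ++ Λ-pairs
  Λ        = Λ-inner ++ Λ-outer

  fits′ : Fits ws′ L
  fits′ = ≡.trans fits (sum-map-↭ weight ws↭ws′)

  labels-chosen : labels Λ-chosen ≡ L
  labels-chosen = labels-assign ws′ fits′

  arcs-chosen : arcs Λ-chosen ↭ chosen
  arcs-chosen = ↭-trans (↭-reflexive (arcs-assign ws′ fits′))
    (↭-trans (concatMap-↭ star (↭-sym ws↭ws′)) stars↭chosen)

  arcs-outer : arcs Λ-outer ↭ outer
  arcs-outer = ↭-trans (↭-reflexive (≡.trans (map-++ proj₁ Λ-chosen _)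
      (cong (arcs Λ-chosen ++_) (≡.trans (map-++ proj₁ Λ-triples Λ-pairs)
        (cong₂ _++_ (arcs-labelTriples triples _ _ _) (arcs-labelPairs pairs _ _))))))
    (↭-trans (Perm.++⁺ʳ _ arcs-chosen) (↭-sym outer↭))

  sorted-arcs : map sorted (arcs Λ) ↭ map sorted edges
  sorted-arcs = ↭-trans (↭-reflexive (≡.trans (cong (map sorted) (map-++ proj₁ Λ-inner Λ-outer))
      (map-++ sorted (arcs Λ-inner) (arcs Λ-outer))))
    (↭-trans (Perm.++⁺ arcs↭ (Perm.map⁺ sorted arcs-outer))
      (↭-reflexive (sym (map-++ sorted inner outer))))

  sorted-arcs! : Unique (map sorted (arcs Λ))
  sorted-arcs! = Unique-resp-↭ (↭-sym sorted-arcs) sorted-edges!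

  labels-Λ : labels Λ ↭ upFrom 1 (x + p + e + p + e)
  labels-Λ = ↭-trans (↭-reflexive (≡.trans (map-++ proj₂ Λ-inner Λ-outer) (cong₂ _++_ labels≡
      (≡.trans (map-++ proj₂ Λ-chosen _) (cong₂ _++_ labels-chosen (map-++ proj₂ Λ-triples Λ-pairs))))))
    (↭-trans (Perm.++⁺ˡ (upFrom 1 s) (Perm.++⁺ˡ L
        (Perm.++⁺ (labels-labelTriples triples _ _ _) (labels-labelPairs pairs _ _))))
      (labels-total s o e p))

  sound : ∀ {u v} → (u , v) ∈ arcs Λ → Adj u v
  sound = [ edges-Adj , symmetric ∘ edges-Adj ]′ ∘ sorted-transfer sorted-arcs

  complete : ∀ {u v} → Adj u v → (u , v) ∈ arcs Λ ⊎ (v , u) ∈ arcs Λ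
  complete uv = [ transfer , Sum.swap ∘ transfer ]′ (edges-complete uv)
    where
    transfer : ∀ {u v} → (u , v) ∈ edges → (u , v) ∈ arcs Λ ⊎ (v , u) ∈ arcs Λ
    transfer = sorted-transfer (↭-sym sorted-arcs)

  -- Opposite arcs have the same sorted form, which occurs only once, so they would coincide and
  -- form a loop.
  antisymmetric : ∀ {u v} → (u , v) ∈ arcs Λ → (v , u) ∉ arcs Λ
  antisymmetric {u} {v} uv∈ vu∈ = loopless
    (cong proj₁ (injective-on-list sorted-arcs! uv∈ vu∈ (sorted-flip (v , u)))) (sound uv∈)

  -- Vertex sums outside and inside the cover

  outer-ends : ∀ {f} → f ∈ arcs Λ-outer → W (proj₁ f) × ¬ W (proj₂ f)
  outer-ends f∈ = proj₁ (∈outer⁻ (Perm.∈-resp-↭ arcs-outer f∈))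

  inner-misses : ∀ {z f} → ¬ W z → f ∈ inner → Misses z f
  inner-misses ¬Wz f∈ =
    (λ eq → ¬Wz (subst W eq (proj₁ (proj₁ (∈inner⁻ f∈))))) , (λ eq → ¬Wz (subst W eq (proj₂ (proj₁ (∈inner⁻ f∈)))))

  no-inner : ∀ {z} → ¬ W z → inSum Λ-inner z ≡ 0 × outSum Λ-inner z ≡ 0
  no-inner ¬Wz = missed (All.tabulate (inner-misses ¬Wz))

  outer-inSum : ∀ {w} → W w → inSum Λ-outer w ≡ 0
  outer-inSum Ww = inSum-absent Λ-outer (λ f∈ eq → proj₂ (outer-ends f∈) (subst W (sym eq) Ww))

  outer-outSum : ∀ {z} → ¬ W z → outSum Λ-outer z ≡ 0
  outer-outSum ¬Wz = outSum-absent Λ-outer (λ f∈ eq → ¬Wz (subst W eq (proj₁ (outer-ends f∈))))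

  excess-¬W : ∀ {z} → ¬ W z → excess Λ z ≡ pos (inSum Λ-outer z)
  excess-¬W {z} ¬Wz = ≡.trans (excess-++ Λ-inner Λ-outer z) (≡.trans
    (cong₂ (λ i o → pos i ℤ.- pos o)
      (cong (_+ inSum Λ-outer z) (proj₁ (no-inner ¬Wz)))
      (cong₂ _+_ (proj₂ (no-inner ¬Wz)) (outer-outSum ¬Wz)))
    (ℤₚ.+-identityʳ (pos (inSum Λ-outer z))))

  excess-W : ∀ {w} → W w → excess Λ w ≡ ℤ.- value ws′ L w
  excess-W {w} Ww = ≡.trans (excess-++ Λ-inner Λ-outer w) (≡.trans
    (cong₂ (λ i o → pos i ℤ.- pos o)
      (cong (inSum Λ-inner w +_) (outer-inSum Ww))
      (cong (outSum Λ-inner w +_) (≡.trans (outSum-++ Λ-chosen (Λ-triples ++ Λ-pairs) w)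
        (cong (outSum Λ-chosen w +_) (outSum-++ Λ-triples Λ-pairs w)))))
    (negate (pos (inSum Λ-inner w)) (pos (outSum Λ-inner w)) (pos (outSum Λ-chosen w))
      (pos (outSum Λ-triples w + outSum Λ-pairs w))))
    where
    negate : ∀ i a f b → (i ℤ.+ 0ℤ) ℤ.- (a ℤ.+ (f ℤ.+ b)) ≡ ℤ.- ((a ℤ.+ b ℤ.- i) ℤ.+ f)
    negate = solve-∀ℤ

  chosen-label : ∀ {z} → z ∈ zs → ∃[ l ] ((centre z , z) , l) ∈ Λ-chosen
  chosen-label z∈ = ∈arcs⁻ Λ-chosen (Perm.∈-resp-↭ (↭-sym arcs-chosen) (∈-map⁺ (λ z → centre z , z) z∈))

  label-bounds : ∀ {f l} → (f , l) ∈ Λ-chosen → s < l × l ≤ x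
  label-bounds ∈Λ = All.lookup L-bounds (subst (_ ∈_) labels-chosen (∈-map⁺ proj₂ ∈Λ))

  heads! : Unique (map proj₂ (arcs Λ-chosen))
  heads! = Unique-resp-↭ (↭-trans (↭-reflexive (sym (≡.trans (sym (map-∘ zs)) (map-id zs))))
    (↭-sym (Perm.map⁺ proj₂ arcs-chosen))) zs!

  -- r is the label of the chosen edge minus 1, shifted if z carries a triple:
  -- triples sum to M + suc (x + p) and pairs sum to M.
  record Residue (z : Fin n) : Set where
    field
      {l r}   : ℕ
      k       : ℕ
      chosen∈ : ((centre z , z) , suc l) ∈ Λ-chosen
      l<x     : l < x
      r<M     : r < M
      inSum≡  : inSum Λ-outer z ≡ suc (r + k * M)
      r≡      : r ≡ l ⊎ r ≡ l + suc (x + p)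

  l+shift<M : ∀ {l} → l < x → l + suc (x + p) < M
  l+shift<M l<x = ℕₚ.+-mono-<-≤ (ℕₚ.<-≤-trans l<x (ℕₚ.m≤m+n x p)) (s≤s (ℕₚ.m≤m+n (x + p) e))

  residue : ∀ {z} → ¬ W z → Residue z
  residue {z} ¬Wz = build (proj₂ (chosen-label (¬W⇒∈zs ¬Wz)))
    (inSum-labelPairs pairs x (suc (x + p + e)) z) (DecMembership._∈?_ _≟_ z (map proj₁ triples))
    where
    total : ∀ {l t m} → ((centre z , z) , l) ∈ Λ-chosen → inSum Λ-triples z ≡ t → inSum Λ-pairs z ≡ m →
      inSum Λ-outer z ≡ l + (t + m)
    total ∈Λ t≡ m≡ = ≡.trans (inSum-++ Λ-chosen (Λ-triples ++ Λ-pairs) z) (cong₂ _+_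
      (inSum-unique Λ-chosen heads! ∈Λ)
      (≡.trans (inSum-++ Λ-triples Λ-pairs z) (cong₂ _+_ t≡ m≡)))
    regroup : ∀ l x p e kM → suc l + (x + suc (x + p) + suc (x + p + e + p) + kM)
      ≡ suc (l + suc (x + p) + (x + p + suc (x + p + e) + kM))
    regroup = solve-∀
    build : ∀ {l} → ((centre z , z) , l) ∈ Λ-chosen → ∃[ k ] inSum Λ-pairs z ≡ k * M →
      Dec (z ∈ map proj₁ triples) → Residue z
    build {zero} ∈Λ _ _ = ⊥-elim (ℕₚ.n≮0 (proj₁ (label-bounds ∈Λ)))
    build {suc l} ∈Λ (k , pairs≡) (no z∉) = record
      { k = k ; chosen∈ = ∈Λ ; l<x = l<x ; r<M = ℕₚ.≤-<-trans (ℕₚ.m≤m+n l _) (l+shift<M l<x)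
      ; r≡ = inj₁ refl
      ; inSum≡ = total ∈Λ (inSum-labelTriples-∉ triples _ _ _ z∉) pairs≡
      }
      where
      l<x : l < x
      l<x = proj₂ (label-bounds ∈Λ)
    build {suc l} ∈Λ (k , pairs≡) (yes z∈) = record
      -- The triple contributes one further `M`; the remainder of its sum is the shift in `r`.
      { k = suc k ; chosen∈ = ∈Λ ; l<x = l<x ; r<M = l+shift<M l<x
      ; r≡ = inj₂ refl
      ; inSum≡ = ≡.trans (total ∈Λ (inSum-labelTriples-∈ triples _ _ _ (triples! zs!) z∈) pairs≡)
          (regroup l x p e (k * M))
      }
      where
      l<x : l < x
      l<x = proj₂ (label-bounds ∈Λ)

  same-label : ∀ {z z′ l l′} → ((centre z , z) , suc l) ∈ Λ-chosen → ((centre z′ , z′) , suc l′) ∈ Λ-chosen →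
    l ≡ l′ → z ≡ z′
  same-label ∈Λ ∈Λ′ refl = cong (proj₂ ∘ proj₁)
    (injective-on-list (subst Unique (sym labels-chosen) L!) ∈Λ ∈Λ′ refl)

  -- Residues without shift lie below `x` and shifted ones above it, so the residue also reveals
  -- whether there is a triple.
  not-shifted : ∀ {l l′} → l < x → l ≢ l′ + suc (x + p)
  not-shifted {_} {l′} l<x refl = ℕₚ.<⇒≱ l<x
    (ℕₚ.≤-trans (ℕₚ.≤-trans (ℕₚ.m≤m+n x p) (ℕₚ.n≤1+n _)) (ℕₚ.m≤n+m _ l′))

  -- The vertex sum determines the residue modulo `M`, this determines the label of the chosen edge,
  -- and no two chosen edges share a label.
  injective-¬W : ∀ {z z′} → ¬ W z → ¬ W z′ → excess Λ z ≡ excess Λ z′ → z ≡ z′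
  injective-¬W {z} {z′} ¬Wz ¬Wz′ eq = same-label (R.chosen∈) (R′.chosen∈) (l≡ R.r≡ R′.r≡)
    where
    module R = Residue (residue ¬Wz)
    module R′ = Residue (residue ¬Wz′)
    r≡r′ : R.r ≡ R′.r
    r≡r′ = %-unique R.k R′.k R.r<M R′.r<M (ℕₚ.suc-injective (≡.trans (sym R.inSum≡) (≡.trans
      (ℤₚ.+-injective (≡.trans (sym (excess-¬W ¬Wz)) (≡.trans eq (excess-¬W ¬Wz′)))) R′.inSum≡)))
    l≡ : R.r ≡ R.l ⊎ R.r ≡ R.l + suc (x + p) → R′.r ≡ R′.l ⊎ R′.r ≡ R′.l + suc (x + p) → R.l ≡ R′.l
    l≡ (inj₁ i) (inj₁ j) = ≡.trans (sym i) (≡.trans r≡r′ j)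
    l≡ (inj₁ i) (inj₂ j) = ⊥-elim (not-shifted R.l<x (≡.trans (sym i) (≡.trans r≡r′ j)))
    l≡ (inj₂ i) (inj₁ j) = ⊥-elim (not-shifted R′.l<x (≡.trans (sym j) (≡.trans (sym r≡r′) i)))
    l≡ (inj₂ i) (inj₂ j) = ℕₚ.+-cancelʳ-≡ (suc (x + p)) R.l R′.l (≡.trans (sym i) (≡.trans r≡r′ j))

  injective-W : ∀ {w w′} → W w → W w′ → excess Λ w ≡ excess Λ w′ → w ≡ w′
  injective-W {w} {w′} Ww Ww′ eq = compare (∈-AllPairs₂ (proj₁ (proj₂ (proj₂ order)))
    (Perm.∈-resp-↭ ws↭ws′ (W⇒∈ws Ww)) (Perm.∈-resp-↭ ws↭ws′ (W⇒∈ws Ww′)))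
    where
    value≡ : value ws′ L w ≡ value ws′ L w′
    value≡ = ℤₚ.neg-injective (≡.trans (sym (excess-W Ww)) (≡.trans eq (excess-W Ww′)))
    compare : w ≡ w′ ⊎ value ws′ L w′ ℤ.< value ws′ L w ⊎ value ws′ L w ℤ.< value ws′ L w′ → w ≡ w′
    compare (inj₁ w≡w′) = w≡w′
    compare (inj₂ (inj₁ w′<w)) = ⊥-elim (ℤₚ.<-irrefl (sym value≡) w′<w)
    compare (inj₂ (inj₂ w<w′)) = ⊥-elim (ℤₚ.<-irrefl value≡ w<w′)

  W-label : ∀ {w} → W w → ∃[ z ] ∃[ l ] ((w , z) , l) ∈ Λ-chosen
  W-label Ww = from (centre-onto Ww)
    where
    from : ∀ {w} → ∃[ z ] ¬ W z × centre z ≡ w → ∃[ z ] ∃[ l ] ((w , z) , l) ∈ Λ-chosen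
    from (z , ¬Wz , refl) = z , chosen-label (¬W⇒∈zs ¬Wz)

  -- By `balance` the inner arcs give `w` an excess of at most `s`, no outer arc enters `w`, and a
  -- chosen edge with a label above `s` leaves it.
  inSum<outSum : ∀ {w} → W w → inSum Λ w < outSum Λ w
  inSum<outSum {w} Ww = compare (W-label Ww)
    where
    open ℕₚ.≤-Reasoning
    compare : ∃[ z ] ∃[ l ] ((w , z) , l) ∈ Λ-chosen → inSum Λ w < outSum Λ w
    compare (z , l , ∈Λ) = begin-strict
      inSum Λ w                            ≡⟨ inSum-++ Λ-inner Λ-outer w ⟩
      inSum Λ-inner w + inSum Λ-outer w    ≡⟨ cong (inSum Λ-inner w +_) (outer-inSum Ww) ⟩
      inSum Λ-inner w + 0                  ≤⟨ ℕₚ.+-monoʳ-≤ (inSum Λ-inner w) z≤n ⟩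
      inSum Λ-inner w + only v₀ w 0        ≤⟨ balance w ⟩
      outSum Λ-inner w + s                 <⟨ ℕₚ.+-monoʳ-< (outSum Λ-inner w) (proj₁ (label-bounds ∈Λ)) ⟩
      outSum Λ-inner w + l                 ≤⟨ ℕₚ.+-monoʳ-≤ (outSum Λ-inner w) (label≤outSum Λ-outer (∈-++⁺ˡ ∈Λ)) ⟩
      outSum Λ-inner w + outSum Λ-outer w  ≡⟨ outSum-++ Λ-inner Λ-outer w ⟨
      outSum Λ w                           ∎

  negative-W : ∀ {w z} → W w → ¬ W z → excess Λ w ≢ excess Λ z
  negative-W {w} {z} Ww ¬Wz eq = ℤₚ.<⇒≱
    (ℤₚ.+-monoˡ-< (ℤ.- pos (outSum Λ w)) (ℤ.+<+ (inSum<outSum Ww)))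
    (ℤₚ.≤-trans (ℤₚ.≤-reflexive (ℤₚ.+-inverseʳ (pos (outSum Λ w))))
      (subst (0ℤ ℤ.≤_) (≡.trans (sym (excess-¬W ¬Wz)) (sym eq)) (ℤ.+≤+ z≤n)))

  excess-injective : Injective _≡_ _≡_ (excess Λ)
  excess-injective {u} {v} = compare (W? u) (W? v)
    where
    compare : Dec (W u) → Dec (W v) → excess Λ u ≡ excess Λ v → u ≡ v
    compare (yes Wu) (yes Wv) eq = injective-W Wu Wv eq
    compare (no ¬Wu) (no ¬Wv) eq = injective-¬W ¬Wu ¬Wv eq
    compare (yes Wu) (no ¬Wv) eq = ⊥-elim (negative-W Wu ¬Wv eq)
    compare (no ¬Wu) (yes Wv) eq = ⊥-elim (negative-W Wv ¬Wu (sym eq))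

  orientation : AdmitsAntimagicOrientation G
  orientation = realise G Λ (x + p + e + p + e) labels-Λ (Uniqueₚ.map⁻ sorted-arcs!)
    sound complete antisymmetric excess-injective

neighbour-exists : (G : Graph n) → (∀ v → Graph.degree G v ≢ 0) → ∀ v → ∃[ u ] Graph.Adj G v u
neighbour-exists G degree≢0 v with any? (λ u → T? (Graph.adj G v u))
... | yes u = u
... | no none = ⊥-elim (degree≢0 v (count-none (Graph.adj G v) (λ u vu → none (u , vu))))

theorem3 : (n : ℕ) (G : Graph n) → Graph.Bipartite G →
    (∀ v → Graph.degree G v ≢ 0 × Graph.degree G v ≢ 2) →
    AdmitsAntimagicOrientation G
-- Without vertices there is no starting point for the trail, so the empty graph is treated apart.
theorem3 zero G _ _ = realise G [] 0 ↭-refl [] (λ ()) (λ { {()} }) (λ ()) (λ { {()} })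
theorem3 (suc n) G bipartite degrees = Construction.orientation G
  (König.starCover G bipartite (neighbour-exists G (proj₁ ∘ degrees))) (proj₂ ∘ degrees) zero
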